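{- Let $G$ be a generalized $(m,n)$-ladder graph with paths $G_1=u_1u_2\cdots u_m$ and $G_2=v_1v_2\cdots v_n$. Then $G$ is planar if and only if for each edge $e\in[G_1,G_2]$, at least one of the following four edge sets is empty: \[L_G^{\uparrow}(e)\cap R_G^{\downarrow}(e);\quad L_G^{\uparrow}(e)\cap R_G^{\uparrow}(e);\quad L_G^{\downarrow}(e)\cap R_G^{\uparrow}(e);\quad L_G^{\downarrow}(e)\cap R_G^{\downarrow}(e).\]
   Context: All graphs are finite, undirected and simple. For positive integers $m,n$, a generalized $(m,n)$-ladder graph is a graph $G$ consisting of two vertex-disjoint paths $G_1=u_1u_2\cdots u_m$ and $G_2=v_1v_2\cdots v_n$ together with some (possibly none) edges each of which joins a vertex of $G_1$ and a vertex of $G_2$; there are no other vertices or edges. Let $[G_1,G_2]$ denote the set of edges of $G$ joining a vertex of $G_1$ to a vertex of $G_2$. For $e\in[G_1,G_2]$, let $l(e)$ be the index $i$ of its end $u_i$ on $G_1$ and $r(e)$ the index $j$ of its end $v_j$ on $G_2$. Define $L_G^{\uparrow}(e)=\{e'\in[G_1,G_2]: l(e)<l(e')\le m\}$, $L_G^{\downarrow}(e)=\{e'\in[G_1,G_2]: 1\le l(e')<l(e)\}$, $R_G^{\uparrow}(e)=\{e'\in[G_1,G_2]: r(e)<r(e')\le n\}$, $R_G^{\downarrow}(e)=\{e'\in[G_1,G_2]: 1\le r(e')<r(e)\}$.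
   Formalization: Planarity is taken to mean the existence of a plane drawing whose edges are polygonal arcs with all vertices and corner points having rational coordinates, instead of a drawing in the real plane. -}

module Defs where

open import Data.Nat using (ℕ; suc)
open import Data.Fin using (Fin; toℕ; inject₁) renaming (suc to fsuc; _<_ to _<ᶠ_)
open import Data.Bool using (Bool; T)
open import Data.Sum using (_⊎_; inj₁; inj₂)
open import Data.Product using (Σ; ∃; _×_; _,_; proj₁; proj₂)
open import Data.List using (List; []; _∷_; _++_; [_]; length; lookup)
open import Data.List.Relation.Unary.Any using (Any)
open import Data.Rational using (ℚ; 0ℚ; 1ℚ; _+_; _*_; _-_; _≤_)
open import Relation.Binary.PropositionalEquality using (_≡_; _≢_)
open import Relation.Nullary using (¬_)
open import Data.Empty using (⊥)

record Graph : Set₁ where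
  field
    V   : Set
    E   : Set
    src : E → V
    tgt : E → V
open Graph public

-- Plane geometry over ℚ (polygonal arcs, as in Diestel, Ch. 4).

Point : Set
Point = ℚ × ℚ

lerp : ℚ → Point → Point → Point
lerp t (a , b) (c , d) = (a + t * (c - a)) , (b + t * (d - b))

OnSeg : Point → Point × Point → Set
OnSeg x (p , q) = Σ ℚ λ t → (0ℚ ≤ t) × (t ≤ 1ℚ) × (x ≡ lerp t p q)

segs : List Point → List (Point × Point)
segs []            = []
segs (p ∷ [])      = []
segs (p ∷ q ∷ ps)  = (p , q) ∷ segs (q ∷ ps)

OnPoly : Point → List Point → Set
OnPoly x ps = Any (OnSeg x) (segs ps)

SimplePoly : List Point → Set
SimplePoly ps =
  (∀ i → proj₁ (lookup (segs ps) i) ≢ proj₂ (lookup (segs ps) i)) ×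
  (∀ i j x → toℕ i Data.Nat.< toℕ j →
     OnSeg x (lookup (segs ps) i) → OnSeg x (lookup (segs ps) j) →
     (toℕ j ≡ suc (toℕ i)) × (x ≡ proj₂ (lookup (segs ps) i)))

record Drawing (G : Graph) : Set where
  field
    pos   : V G → Point
    bends : E G → List Point
  poly : E G → List Point
  poly e = pos (src G e) ∷ (bends e ++ [ pos (tgt G e) ])
  field
    pos-inj     : ∀ u v → pos u ≡ pos v → u ≡ v
    arc-simple  : ∀ e → SimplePoly (poly e)
    arc-avoids  : ∀ e v → OnPoly (pos v) (poly e) → (v ≡ src G e) ⊎ (v ≡ tgt G e)
    arcs-meet   : ∀ e f x → e ≢ f → OnPoly x (poly e) → OnPoly x (poly f) →
                  Σ (V G) λ v → x ≡ pos v

Planar : Graph → Set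
Planar G = Drawing G

-- Generalized (m,n)-ladder graphs, m = suc k, n = suc l.
-- u_i ↦ inj₁ i, v_j ↦ inj₂ j (0-indexed); R i j = true iff u_i v_j ∈ [G1,G2].

data LadderEdge (k l : ℕ) (R : Fin (suc k) → Fin (suc l) → Bool) : Set where
  uEdge : Fin k → LadderEdge k l R
  vEdge : Fin l → LadderEdge k l R
  rung  : (i : Fin (suc k)) (j : Fin (suc l)) → T (R i j) → LadderEdge k l R

module _ {k l : ℕ} {R : Fin (suc k) → Fin (suc l) → Bool} where
  lsrc : LadderEdge k l R → Fin (suc k) ⊎ Fin (suc l)
  lsrc (uEdge i)    = inj₁ (inject₁ i)
  lsrc (vEdge j)    = inj₂ (inject₁ j)
  lsrc (rung i j _) = inj₁ i

  ltgt : LadderEdge k l R → Fin (suc k) ⊎ Fin (suc l)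
  ltgt (uEdge i)    = inj₁ (fsuc i)
  ltgt (vEdge j)    = inj₂ (fsuc j)
  ltgt (rung i j _) = inj₂ j

Ladder : (k l : ℕ) → (Fin (suc k) → Fin (suc l) → Bool) → Graph
Ladder k l R = record
  { V = Fin (suc k) ⊎ Fin (suc l) ; E = LadderEdge k l R ; src = lsrc ; tgt = ltgt }

Rung : (k l : ℕ) → (Fin (suc k) → Fin (suc l) → Bool) → Set
Rung k l R = Σ (Fin (suc k) × Fin (suc l)) λ p → T (R (proj₁ p) (proj₂ p))

module _ {k l : ℕ} {R : Fin (suc k) → Fin (suc l) → Bool} where
  lidx : Rung k l R → Fin (suc k)
  lidx ((i , _) , _) = i
  ridx : Rung k l R → Fin (suc l)
  ridx ((_ , j) , _) = j

  L↑ L↓ R↑ R↓ : Rung k l R → Rung k l R → Set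
  L↑ e e' = lidx e <ᶠ lidx e'
  L↓ e e' = lidx e' <ᶠ lidx e
  R↑ e e' = ridx e <ᶠ ridx e'
  R↓ e e' = ridx e' <ᶠ ridx e

  EmptyCap : (Rung k l R → Set) → (Rung k l R → Set) → Set
  EmptyCap A B = ¬ (Σ (Rung k l R) λ e' → A e' × B e')

{-# OPTIONS --safe #-}
-- Necessity.  Perturb the vertical direction by the lexicographic order on ℚ².  For disjoint polygonal arcs, the
-- vector from a point of one to a point of the other never vanishes, so along the boundary of the product of the
-- arcs it crosses the upward vertical an even number of times.  This gives, mod 2, a relation between the numbers
-- of times each arc passes above the end points of the other (and the order of these end points).  If all four
-- quadrants at a rung u_a v_b contain rungs, contracting the parts of the two paths above and below a and b gives
-- a K₃,₃ minor; adding the relations for the six pairs of independent paths from x_i and x_i' to the y_j shows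
-- that the parities Σ_{j ≠ j'} [path x_i y_j passes above y_j'] differ for i ≠ i', impossible for three values of i.
--
-- Sufficiency.  Put u_m, …, u_1 and v_1, …, v_n from left to right on the x-axis.  The rungs with no rung to their
-- upper left (in the grid of pairs (i, j)) form an increasing chain, those with none to their upper right a
-- decreasing one, and so on: the four chains are the sides of the orthogonal convex hull of the rungs.  NW rungs
-- are drawn above the axis and SE rungs below it; SW rungs start below, pass between u_1 and v_1 and continue
-- above, NE rungs start above and come back below around v_n.  Each piece is a triangular tent, and two tents
-- around the same centre are nested by monotonicity of the chains.
module Submission where

open import Defs
open import Data.Bool using (Bool; true; false; T; not; _∧_; _xor_)
open import Data.Bool.Properties using (T?; T-irrelevant; xor-comm; xor-same)
open import Data.Bool.Solver using (module xor-∧-Solver)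
open import Data.Empty using (⊥; ⊥-elim)
open import Data.Fin as Fin using (Fin; zero; suc; inject₁; toℕ)
import Data.Fin.Properties as Finₚ
open import Data.Fin.Induction using (<-weakInduction)
open import Data.Fin.Patterns using (0F; 1F; 2F)
open import Data.List using (List; []; _∷_; _++_; [_]; length; lookup)
open import Data.List.Membership.Propositional using (lose)
open import Data.List.Membership.Propositional.Properties using (∈-lookup)
open import Data.List.Relation.Unary.Any using (here; there)
open import Data.Maybe using (Maybe; just; nothing)
open import Data.Nat as ℕ using (ℕ; zero; suc)
import Data.Nat.Properties as ℕₚ
open import Data.Product using (Σ; ∃; _×_; _,_; proj₁; proj₂)
open import Data.Sum as Sum using (_⊎_; inj₁; inj₂; [_,_]′)
open import Data.Rational as ℚ using (ℚ; 0ℚ; 1ℚ; _+_; _*_; _-_; -_; _≤_; _<_; positive; nonNegative; 1/_)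
import Data.Rational.Properties as ℚₚ
open import Function.Bundles using (_⇔_; mk⇔)
open import Level using (0ℓ)
open import Relation.Nullary using (¬_; Dec; yes; no; does)
open import Relation.Nullary.Decidable using (map′; _×-dec_; dec-true; dec-false)
open import Relation.Unary using (Decidable)
open import Relation.Binary using (tri<; tri≈; tri>)
open import Relation.Binary.PropositionalEquality
  using (_≡_; _≢_; refl; sym; trans; cong; cong₂; subst; subst₂; ≢-sym)
open import Tactic.RingSolver using (solve-∀)
open import Tactic.RingSolver.Core.AlmostCommutativeRing using (AlmostCommutativeRing; fromCommutativeRing)

-- Signs in ℚ

0≟ : ∀ x → Maybe (0ℚ ≡ x)
0≟ x with 0ℚ ℚₚ.≟ x
... | yes p = just p
... | no _  = nothing

ℚ-ring : AlmostCommutativeRing 0ℓ 0ℓ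
ℚ-ring = fromCommutativeRing ℚₚ.+-*-commutativeRing 0≟

p≤q⇒0≤q-p : ∀ {p q} → p ≤ q → 0ℚ ≤ q - p
p≤q⇒0≤q-p {p} {q} h = subst (_≤ q - p) (ℚₚ.+-inverseʳ p) (ℚₚ.+-monoˡ-≤ (- p) h)

0≤q-p⇒p≤q : ∀ {p q} → 0ℚ ≤ q - p → p ≤ q
0≤q-p⇒p≤q {p} {q} h = subst₂ _≤_ (ℚₚ.+-identityˡ p) (e q p) (ℚₚ.+-monoˡ-≤ p h)
  where
  e : ∀ q p → q - p + p ≡ q
  e = solve-∀ ℚ-ring

p<q⇒0<q-p : ∀ {p q} → p < q → 0ℚ < q - p
p<q⇒0<q-p {p} {q} h = subst (_< q - p) (ℚₚ.+-inverseʳ p) (ℚₚ.+-monoˡ-< (- p) h)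

0<q-p⇒p<q : ∀ {p q} → 0ℚ < q - p → p < q
0<q-p⇒p<q {p} {q} h = subst₂ _<_ (ℚₚ.+-identityˡ p) (e q p) (ℚₚ.+-monoˡ-< p h)
  where
  e : ∀ q p → q - p + p ≡ q
  e = solve-∀ ℚ-ring

0≤p+q : ∀ {p q} → 0ℚ ≤ p → 0ℚ ≤ q → 0ℚ ≤ p + q
0≤p+q = ℚₚ.+-mono-≤

0<p+q : ∀ {p q} → 0ℚ < p → 0ℚ ≤ q → 0ℚ < p + q
0<p+q = ℚₚ.+-mono-<-≤

0≤p*q : ∀ {p q} → 0ℚ ≤ p → 0ℚ ≤ q → 0ℚ ≤ p * q
0≤p*q {p} {q} hp hq = ℚₚ.nonNegative⁻¹ (p * q)
  {{ℚₚ.nonNeg*nonNeg⇒nonNeg p {{nonNegative hp}} q {{nonNegative hq}}}}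

0<p*q : ∀ {p q} → 0ℚ < p → 0ℚ < q → 0ℚ < p * q
0<p*q {p} {q} hp hq = ℚₚ.positive⁻¹ (p * q) {{ℚₚ.pos*pos⇒pos p {{positive hp}} q {{positive hq}}}}

p≤0⇒0≤-p : ∀ {p} → p ≤ 0ℚ → 0ℚ ≤ - p
p≤0⇒0≤-p = ℚₚ.neg-antimono-≤

p<0⇒0<-p : ∀ {p} → p < 0ℚ → 0ℚ < - p
p<0⇒0<-p = ℚₚ.neg-antimono-<

0≤-p⇒p≤0 : ∀ {p} → 0ℚ ≤ - p → p ≤ 0ℚ
0≤-p⇒p≤0 {p} h = subst (_≤ 0ℚ) (e p) (ℚₚ.neg-antimono-≤ h)
  where
  e : ∀ p → - (- p) ≡ p
  e = solve-∀ ℚ-ring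

p-q≡0⇒p≡q : ∀ {p q} → p - q ≡ 0ℚ → p ≡ q
p-q≡0⇒p≡q {p} {q} h = trans (sym (e p q)) (trans (cong (_+ q) h) (ℚₚ.+-identityˡ q))
  where
  e : ∀ p q → p - q + q ≡ p
  e = solve-∀ ℚ-ring

0<p⇒p-invertible : ∀ {p} → 0ℚ < p → Σ ℚ λ r → 0ℚ < r × p * r ≡ 1ℚ
0<p⇒p-invertible {p} h = _ , ℚₚ.positive⁻¹ r {{ℚₚ.1/pos⇒pos p {{positive h}}}} , ℚₚ.*-inverseʳ p {{nz}}
  where
  nz = ℚₚ.pos⇒nonZero p {{positive h}}
  r = (1/ p) {{nz}}

0≤p∧p≢0⇒0<p : ∀ {p} → 0ℚ ≤ p → p ≢ 0ℚ → 0ℚ < p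
0≤p∧p≢0⇒0<p 0≤p p≢0 = ℚₚ.≰⇒> λ p≤0 → p≢0 (ℚₚ.≤-antisym p≤0 0≤p)

0≤p∧0≤q∧p+q≡0⇒p≡0 : ∀ {p q} → 0ℚ ≤ p → 0ℚ ≤ q → p + q ≡ 0ℚ → p ≡ 0ℚ
0≤p∧0≤q∧p+q≡0⇒p≡0 {p} hp hq e with p ℚₚ.≟ 0ℚ
... | yes p≡0 = p≡0
... | no p≢0  = ⊥-elim (ℚₚ.<-irrefl (sym e) (0<p+q (0≤p∧p≢0⇒0<p hp p≢0) hq))

onSeg-start : ∀ p q → OnSeg p (p , q)
onSeg-start (p₁ , p₂) (q₁ , q₂) = 0ℚ , ℚₚ.≤-refl , ℚₚ.<⇒≤ (ℚₚ.positive⁻¹ 1ℚ) , cong₂ _,_ (e p₁ q₁) (e p₂ q₂)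
  where
  e : ∀ a b → a ≡ a + 0ℚ * (b - a)
  e = solve-∀ ℚ-ring

onSeg-sym : ∀ {x} p q → OnSeg x (p , q) → OnSeg x (q , p)
onSeg-sym (p₁ , p₂) (q₁ , q₂) (t , 0≤t , t≤1 , refl) =
  1ℚ - t , p≤q⇒0≤q-p t≤1 , 0≤q-p⇒p≤q (subst (0ℚ ≤_) (e' t) 0≤t) , cong₂ _,_ (e t p₁ q₁) (e t p₂ q₂)
  where
  e : ∀ t a b → a + t * (b - a) ≡ b + (1ℚ - t) * (a - b)
  e = solve-∀ ℚ-ring
  e' : ∀ t → t ≡ 1ℚ - (1ℚ - t)
  e' = solve-∀ ℚ-ring

onSeg-end : ∀ p q → OnSeg q (p , q)
onSeg-end p q = onSeg-sym q p (onSeg-start q p)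

-- Segments and the lexicographic order of the plane

infixl 6 _⊖_
_⊖_ : Point → Point → Point
(a , b) ⊖ (c , d) = a - c , b - d

infix 8 _⨯_
_⨯_ : Point → Point → ℚ
(a , b) ⨯ (c , d) = a * d - b * c

-- Positivity of a + ε b for an infinitesimal ε > 0: the sign of the horizontal coordinate once the
-- vertical is slightly tilted. After the tilt no nonzero vector is vertical.
LexPos : Point → Set
LexPos (a , b) = 0ℚ < a ⊎ (0ℚ ≡ a × 0ℚ < b)

infix 4 _≺_
_≺_ : Point → Point → Set
p ≺ q = LexPos (q ⊖ p)

lexPos-irrefl : ¬ LexPos (0ℚ , 0ℚ)
lexPos-irrefl (inj₁ h)       = ℚₚ.<-irrefl refl h
lexPos-irrefl (inj₂ (_ , h)) = ℚₚ.<-irrefl refl h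

LexNonNeg : Point → Set
LexNonNeg (a , b) = LexPos (a , b) ⊎ (0ℚ ≡ a × 0ℚ ≡ b)

lexPos+nonNeg : ∀ {a b c d} → LexPos (a , b) → LexNonNeg (c , d) → LexPos (a + c , b + d)
lexPos+nonNeg (inj₁ h) (inj₁ (inj₁ h'))              = inj₁ (0<p+q h (ℚₚ.<⇒≤ h'))
lexPos+nonNeg (inj₁ h) (inj₁ (inj₂ (refl , h')))     = inj₁ (0<p+q h ℚₚ.≤-refl)
lexPos+nonNeg (inj₁ h) (inj₂ (refl , h'))            = inj₁ (0<p+q h ℚₚ.≤-refl)
lexPos+nonNeg (inj₂ (refl , h)) (inj₁ (inj₁ h'))     = inj₁ (ℚₚ.+-mono-≤-< ℚₚ.≤-refl h')
lexPos+nonNeg (inj₂ (refl , h)) (inj₁ (inj₂ (refl , h'))) = inj₂ (refl , 0<p+q h (ℚₚ.<⇒≤ h'))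
lexPos+nonNeg (inj₂ (refl , h)) (inj₂ (refl , refl)) = inj₂ (refl , 0<p+q h ℚₚ.≤-refl)

lexPos-* : ∀ {r a b} → 0ℚ < r → LexPos (a , b) → LexPos (r * a , r * b)
lexPos-* hr (inj₁ h) = inj₁ (0<p*q hr h)
lexPos-* {r} hr (inj₂ (refl , h)) = inj₂ (sym (ℚₚ.*-zeroʳ r) , 0<p*q hr h)

lexNonNeg-* : ∀ {r a b} → 0ℚ ≤ r → LexPos (a , b) → LexNonNeg (r * a , r * b)
lexNonNeg-* {r} {a} {b} hr h with r ℚₚ.≟ 0ℚ
... | yes refl = inj₂ (sym (ℚₚ.*-zeroˡ a) , sym (ℚₚ.*-zeroˡ b))
... | no r≢0   = inj₁ (lexPos-* (0≤p∧p≢0⇒0<p hr r≢0) h)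

-- Lexicographically positive vectors form a convex cone that misses the origin.
lexPos-combination≢0 : ∀ {r s t x₁ x₂ y₁ y₂ z₁ z₂} →
  LexPos (x₁ , x₂) → LexPos (y₁ , y₂) → LexPos (z₁ , z₂) → 0ℚ < r → 0ℚ ≤ s → 0ℚ ≤ t →
  r * x₁ + s * y₁ + t * z₁ ≡ 0ℚ → r * x₂ + s * y₂ + t * z₂ ≡ 0ℚ → ⊥
lexPos-combination≢0 x y z hr hs ht e₁ e₂ =
  lexPos-irrefl (subst LexPos (cong₂ _,_ e₁ e₂)
    (lexPos+nonNeg (lexPos+nonNeg (lexPos-* hr x) (lexNonNeg-* hs y)) (lexNonNeg-* ht z)))

≺-trans : ∀ {p q r} → p ≺ q → q ≺ r → p ≺ r
≺-trans {p₁ , p₂} {q₁ , q₂} {r₁ , r₂} h h' =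
  subst LexPos (cong₂ _,_ (e p₁ q₁ r₁) (e p₂ q₂ r₂)) (lexPos+nonNeg h (inj₁ h'))
  where
  e : ∀ p q r → q - p + (r - q) ≡ r - p
  e = solve-∀ ℚ-ring

≺-irrefl : ∀ {p} → ¬ p ≺ p
≺-irrefl {p₁ , p₂} h = lexPos-irrefl (subst LexPos (cong₂ _,_ (ℚₚ.+-inverseʳ p₁) (ℚₚ.+-inverseʳ p₂)) h)

lexPos? : ∀ v → Dec (LexPos v)
lexPos? (a , b) with 0ℚ ℚₚ.<? a | 0ℚ ℚₚ.≟ a | 0ℚ ℚₚ.<? b
... | yes h | _       | _      = yes (inj₁ h)
... | no h  | no h'   | _      = no λ { (inj₁ k) → h k ; (inj₂ (k , _)) → h' k }
... | no h  | yes h'  | yes h″ = yes (inj₂ (h' , h″))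
... | no h  | yes h'  | no h″  = no λ { (inj₁ k) → h k ; (inj₂ (_ , k)) → h″ k }

≺-connex : ∀ {p q} → p ≢ q → p ≺ q ⊎ q ≺ p
≺-connex {p₁ , p₂} {q₁ , q₂} p≢q with ℚₚ.<-cmp p₁ q₁
... | tri< h _ _ = inj₁ (inj₁ (p<q⇒0<q-p h))
... | tri> _ _ h = inj₂ (inj₁ (p<q⇒0<q-p h))
... | tri≈ _ refl _ with ℚₚ.<-cmp p₂ q₂
...   | tri< h _ _    = inj₁ (inj₂ (sym (ℚₚ.+-inverseʳ p₁) , p<q⇒0<q-p h))
...   | tri> _ _ h    = inj₂ (inj₂ (sym (ℚₚ.+-inverseʳ p₁) , p<q⇒0<q-p h))
...   | tri≈ _ refl _ = ⊥-elim (p≢q refl)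

lt : Point → Point → Bool
lt p q = does (lexPos? (q ⊖ p))

≺⇒lt : ∀ {p q} → p ≺ q → lt p q ≡ true
≺⇒lt {p} {q} h = dec-true (lexPos? (q ⊖ p)) h

≺⇒gt : ∀ {p q} → p ≺ q → lt q p ≡ false
≺⇒gt {p} {q} h = dec-false (lexPos? (p ⊖ q)) (λ h' → ≺-irrefl {p} (≺-trans {p} {q} {p} h h'))

lt-not : ∀ {p q} → p ≢ q → lt p q ≡ not (lt q p)
lt-not {p} {q} h with ≺-connex h
... | inj₁ k = trans (≺⇒lt {p} {q} k) (cong not (sym (≺⇒gt {p} {q} k)))
... | inj₂ k = trans (≺⇒gt {q} {p} k) (cong not (sym (≺⇒lt {q} {p} k)))

-- Disjoint segments and the sides of their end points

DisjointSegs : Point → Point → Point → Point → Set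
DisjointSegs p q a b = ∀ x → OnSeg x (p , q) → OnSeg x (a , b) → ⊥

cross-linear₁ : ∀ x₁ x₂ y₁ y₂ z₁ z₂ →
  (x₁ * y₂ - x₂ * y₁) * z₁ + (y₁ * z₂ - y₂ * z₁) * x₁ - (x₁ * z₂ - x₂ * z₁) * y₁ ≡ 0ℚ
cross-linear₁ = solve-∀ ℚ-ring

cross-linear₂ : ∀ x₁ x₂ y₁ y₂ z₁ z₂ →
  (x₁ * y₂ - x₂ * y₁) * z₂ + (y₁ * z₂ - y₂ * z₁) * x₂ - (x₁ * z₂ - x₂ * z₁) * y₂ ≡ 0ℚ
cross-linear₂ = solve-∀ ℚ-ring

-- Cramer's rule. The determinant of the directions of `pq` and `ab` is `x ⨯ y - y ⨯ z`, its inverse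
-- is `δ`, and the four sign hypotheses put both parameters of the intersection point between 0 and
-- 1. Carrying `δ` along allows a determinant of either sign.
crossing-nested : ∀ p a b q δ → let x = a ⊖ p; y = b ⊖ a; z = q ⊖ b in
  (x ⨯ y - y ⨯ z) * δ ≡ 1ℚ →
  0ℚ ≤ x ⨯ y * δ → 0ℚ ≤ - (y ⨯ z) * δ →
  0ℚ ≤ (x ⨯ y + x ⨯ z) * δ → 0ℚ ≤ - (x ⨯ z + y ⨯ z) * δ →
  ¬ DisjointSegs p q a b
crossing-nested p@(p₁ , p₂) a@(a₁ , a₂) b@(b₁ , b₂) q@(q₁ , q₂) δ k h₁ h₂ h₃ h₄ d =
  d (lerp t p q) (t , h₁ , 0≤q-p⇒p≤q (subst (0ℚ ≤_) (e₁ α γ δ k) h₂) , refl)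
    (s , h₃ , 0≤q-p⇒p≤q (subst (0ℚ ≤_) (e₂ α β γ δ k) h₄) ,
     cong₂ _,_
       (coord α β γ δ p₁ a₁ b₁ q₁ k
         (cross-linear₁ (a₁ - p₁) (a₂ - p₂) (b₁ - a₁) (b₂ - a₂) (q₁ - b₁) (q₂ - b₂)))
       (coord α β γ δ p₂ a₂ b₂ q₂ k
         (cross-linear₂ (a₁ - p₁) (a₂ - p₂) (b₁ - a₁) (b₂ - a₂) (q₁ - b₁) (q₂ - b₂))))
  where
  α = (a ⊖ p) ⨯ (b ⊖ a)
  β = (a ⊖ p) ⨯ (q ⊖ b)
  γ = (b ⊖ a) ⨯ (q ⊖ b)
  t = α * δ
  s = (α + β) * δ
  e₁ : ∀ α γ δ → (α - γ) * δ ≡ 1ℚ → - γ * δ ≡ 1ℚ - α * δ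
  e₁ α γ δ k = trans (i α γ δ) (cong (_- α * δ) k)
    where
    i : ∀ α γ δ → - γ * δ ≡ (α - γ) * δ - α * δ
    i = solve-∀ ℚ-ring
  e₂ : ∀ α β γ δ → (α - γ) * δ ≡ 1ℚ → - (β + γ) * δ ≡ 1ℚ - (α + β) * δ
  e₂ α β γ δ k = trans (i α β γ δ) (cong (_- (α + β) * δ) k)
    where
    i : ∀ α β γ δ → - (β + γ) * δ ≡ (α - γ) * δ - (α + β) * δ
    i = solve-∀ ℚ-ring
  coord : ∀ α β γ δ p a b q → (α - γ) * δ ≡ 1ℚ →
    α * (q - b) + γ * (a - p) - β * (b - a) ≡ 0ℚ →
    p + α * δ * (q - p) ≡ a + (α + β) * δ * (b - a)
  coord α β γ δ p a b q k r = trans (i α β γ δ p a b q)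
    (trans (cong₂ (λ u v → a + (α + β) * δ * (b - a) + (u - 1ℚ) * (a - p) + δ * v) k r) (j _ (a - p) δ))
    where
    i : ∀ α β γ δ p a b q → p + α * δ * (q - p) ≡
      a + (α + β) * δ * (b - a) + ((α - γ) * δ - 1ℚ) * (a - p) + δ * (α * (q - b) + γ * (a - p) - β * (b - a))
    i = solve-∀ ℚ-ring
    j : ∀ u v δ → u + (1ℚ - 1ℚ) * v + δ * 0ℚ ≡ u
    j = solve-∀ ℚ-ring

-- Cramer's rule again, for the path through `p`, `a`, `q`, `b`: with these differences the
-- determinant of the directions of `pq` and `ab` becomes the sum of the three cross products.
crossing-interleaved : ∀ p a q b δ → let x = a ⊖ p; y = q ⊖ a; z = b ⊖ q in
  (x ⨯ y + x ⨯ z + y ⨯ z) * δ ≡ 1ℚ →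
  0ℚ ≤ x ⨯ y * δ → 0ℚ ≤ x ⨯ z * δ → 0ℚ ≤ y ⨯ z * δ →
  ¬ DisjointSegs p q a b
crossing-interleaved p@(p₁ , p₂) a@(a₁ , a₂) q@(q₁ , q₂) b@(b₁ , b₂) δ k h₁ h₂ h₃ d =
  d (lerp t p q)
    (t , subst (0ℚ ≤_) (e₀ α β δ) (0≤p+q h₁ h₂) , 0≤q-p⇒p≤q (subst (0ℚ ≤_) (e₁ α β γ δ k) h₃) , refl)
    (s , h₁ , 0≤q-p⇒p≤q (subst (0ℚ ≤_) (e₂ α β γ δ k) (0≤p+q h₂ h₃)) ,
     cong₂ _,_
       (coord α β γ δ p₁ a₁ q₁ b₁ k
         (cross-linear₁ (a₁ - p₁) (a₂ - p₂) (q₁ - a₁) (q₂ - a₂) (b₁ - q₁) (b₂ - q₂)))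
       (coord α β γ δ p₂ a₂ q₂ b₂ k
         (cross-linear₂ (a₁ - p₁) (a₂ - p₂) (q₁ - a₁) (q₂ - a₂) (b₁ - q₁) (b₂ - q₂))))
  where
  α = (a ⊖ p) ⨯ (q ⊖ a)
  β = (a ⊖ p) ⨯ (b ⊖ q)
  γ = (q ⊖ a) ⨯ (b ⊖ q)
  t = (α + β) * δ
  s = α * δ
  e₀ : ∀ α β δ → α * δ + β * δ ≡ (α + β) * δ
  e₀ = solve-∀ ℚ-ring
  e₁ : ∀ α β γ δ → (α + β + γ) * δ ≡ 1ℚ → γ * δ ≡ 1ℚ - (α + β) * δ
  e₁ α β γ δ k = trans (i α β γ δ) (cong (_- (α + β) * δ) k)
    where
    i : ∀ α β γ δ → γ * δ ≡ (α + β + γ) * δ - (α + β) * δ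
    i = solve-∀ ℚ-ring
  e₂ : ∀ α β γ δ → (α + β + γ) * δ ≡ 1ℚ → β * δ + γ * δ ≡ 1ℚ - α * δ
  e₂ α β γ δ k = trans (i α β γ δ) (cong (_- α * δ) k)
    where
    i : ∀ α β γ δ → β * δ + γ * δ ≡ (α + β + γ) * δ - α * δ
    i = solve-∀ ℚ-ring
  coord : ∀ α β γ δ p a q b → (α + β + γ) * δ ≡ 1ℚ →
    α * (b - q) + γ * (a - p) - β * (q - a) ≡ 0ℚ →
    p + (α + β) * δ * (q - p) ≡ a + α * δ * (b - a)
  coord α β γ δ p a q b k r = trans (i α β γ δ p a q b)
    (trans (cong₂ (λ u v → a + α * δ * (b - a) + (u - 1ℚ) * (a - p) - δ * v) k r) (j _ (a - p) δ))
    where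
    i : ∀ α β γ δ p a q b → p + (α + β) * δ * (q - p) ≡
      a + α * δ * (b - a) + ((α + β + γ) * δ - 1ℚ) * (a - p) - δ * (α * (b - q) + γ * (a - p) - β * (q - a))
    i = solve-∀ ℚ-ring
    j : ∀ u v δ → u + (1ℚ - 1ℚ) * v - δ * 0ℚ ≡ u
    j = solve-∀ ℚ-ring

collinear-between : ∀ p v q → p ≺ v → v ≺ q → (v ⊖ p) ⨯ (q ⊖ v) ≡ 0ℚ → OnSeg v (p , q)
collinear-between (p₁ , p₂) (v₁ , v₂) (q₁ , q₂) = go
  where
  x₁ = v₁ - p₁
  x₂ = v₂ - p₂
  y₁ = q₁ - v₁
  y₂ = q₂ - v₂
  e₁ : ∀ x y r → (x + y) * r ≡ 1ℚ → y * r ≡ 1ℚ - x * r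
  e₁ x y r k = trans (i x y r) (cong (_- x * r) k)
    where
    i : ∀ x y r → y * r ≡ (x + y) * r - x * r
    i = solve-∀ ℚ-ring
  c : ∀ x y r p v q → x ≡ v - p → y ≡ q - v → (x + y) * r ≡ 1ℚ → v ≡ p + x * r * (q - p)
  c _ _ r p v q refl refl k = trans (i r p v q) (trans (cong (λ u → p + (v - p) * u) (sym k)) (j r p v q))
    where
    i : ∀ r p v q → v ≡ p + (v - p) * 1ℚ
    i = solve-∀ ℚ-ring
    j : ∀ r p v q → p + (v - p) * ((v - p + (q - v)) * r) ≡ p + (v - p) * r * (q - p)
    j = solve-∀ ℚ-ring
  d : ∀ x₁ y₁ r p v q → (x₁ + y₁) * r ≡ 1ℚ → x₁ * (q - v) - (v - p) * y₁ ≡ 0ℚ → v ≡ p + x₁ * r * (q - p)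
  d x₁ y₁ r p v q k h = trans (i r p v) (trans (cong₂ (λ u w → p + (v - p) * u + r * w) (sym k) (sym h)) (j x₁ y₁ r p v q))
    where
    i : ∀ r p v → v ≡ p + (v - p) * 1ℚ + r * 0ℚ
    i = solve-∀ ℚ-ring
    j : ∀ x₁ y₁ r p v q → p + (v - p) * ((x₁ + y₁) * r) + r * (x₁ * (q - v) - (v - p) * y₁) ≡ p + x₁ * r * (q - p)
    j = solve-∀ ℚ-ring
  0≤1st : ∀ {v w} → LexPos (v , w) → 0ℚ ≤ v
  0≤1st (inj₁ h)          = ℚₚ.<⇒≤ h
  0≤1st (inj₂ (refl , _)) = ℚₚ.≤-refl
  -- The segment is not vertical in this case, so the ratio of the first coordinates is the
  -- parameter of `v`.
  steep : 0ℚ < x₁ + y₁ → 0ℚ ≤ x₁ → 0ℚ ≤ y₁ → x₁ * y₂ - x₂ * y₁ ≡ 0ℚ → OnSeg (v₁ , v₂) ((p₁ , p₂) , (q₁ , q₂))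
  steep hs hx hy col with 0<p⇒p-invertible hs
  ... | r , hr , k = x₁ * r , 0≤p*q hx (ℚₚ.<⇒≤ hr) , 0≤q-p⇒p≤q (subst (0ℚ ≤_) (e₁ x₁ y₁ r k) (0≤p*q hy (ℚₚ.<⇒≤ hr))) ,
    cong₂ _,_ (c x₁ y₁ r p₁ v₁ q₁ refl refl k) (d x₁ y₁ r p₂ v₂ q₂ k col)
  go : LexPos (x₁ , x₂) → LexPos (y₁ , y₂) → x₁ * y₂ - x₂ * y₁ ≡ 0ℚ → OnSeg (v₁ , v₂) ((p₁ , p₂) , (q₁ , q₂))
  go (inj₁ hx) hy col = steep (0<p+q hx (0≤1st hy)) (ℚₚ.<⇒≤ hx) (0≤1st hy) col
  go hx@(inj₂ _) (inj₁ hy) col = steep (ℚₚ.+-mono-≤-< (0≤1st hx) hy) (0≤1st hx) (ℚₚ.<⇒≤ hy) col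
  -- All three points lie on one vertical line, so the parameter has to come from the second
  -- coordinates.
  go (inj₂ (ex , hx)) (inj₂ (ey , hy)) _ with 0<p⇒p-invertible (0<p+q hx (ℚₚ.<⇒≤ hy))
  ... | r , hr , k = x₂ * r , 0≤p*q (ℚₚ.<⇒≤ hx) (ℚₚ.<⇒≤ hr) ,
    0≤q-p⇒p≤q (subst (0ℚ ≤_) (e₁ x₂ y₂ r k) (0≤p*q (ℚₚ.<⇒≤ hy) (ℚₚ.<⇒≤ hr))) ,
    cong₂ _,_ vertical (c x₂ y₂ r p₂ v₂ q₂ refl refl k)
    where
    v₁≡p₁ = p-q≡0⇒p≡q {v₁} {p₁} (sym ex)
    q₁≡v₁ = p-q≡0⇒p≡q {q₁} {v₁} (sym ey)
    i : ∀ p t → p ≡ p + t * (p - p)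
    i = solve-∀ ℚ-ring
    vertical : v₁ ≡ p₁ + x₂ * r * (q₁ - p₁)
    vertical = trans v₁≡p₁ (trans (i p₁ (x₂ * r)) (cong (λ u → p₁ + x₂ * r * (u - p₁)) (sym (trans q₁≡v₁ v₁≡p₁))))

isPos : ℚ → Bool
isPos c = does (0ℚ ℚₚ.<? c)

true≢false : true ≢ false
true≢false ()

isPos-true : ∀ {c} → isPos c ≡ true → 0ℚ < c
isPos-true {c} h = ℚₚ.≰⇒> λ c≤0 → true≢false
  (trans (sym h) (dec-false (0ℚ ℚₚ.<? c) λ 0<c → ℚₚ.<-irrefl refl (ℚₚ.<-≤-trans 0<c c≤0)))

isPos-false : ∀ {c} → isPos c ≡ false → c ≤ 0ℚ
isPos-false {c} h = ℚₚ.≮⇒≥ λ 0<c → true≢false (trans (sym (dec-true (0ℚ ℚₚ.<? c) 0<c)) h)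

-- What the linear relation (x⨯y) z + (y⨯z) x = (x⨯z) y says about signs when x, y, z are lexicographically positive.
SignRelation : ℚ → ℚ → ℚ → Set
SignRelation α β γ =
  (0ℚ < α → 0ℚ ≤ γ → 0ℚ < β) × (0ℚ ≤ α → 0ℚ < γ → 0ℚ < β) ×
  (α < 0ℚ → γ ≤ 0ℚ → β < 0ℚ) × (α ≤ 0ℚ → γ < 0ℚ → β < 0ℚ)

signRelation-sym : ∀ {α β γ} → SignRelation α β γ → SignRelation γ β α
signRelation-sym (r₁ , r₂ , r₃ , r₄) =
  (λ γ α → r₂ α γ) , (λ γ α → r₁ α γ) , (λ γ α → r₄ α γ) , (λ γ α → r₃ α γ)

-- If `x ⨯ z` had the wrong sign, the linear relation would be a vanishing combination of
-- lexicographically positive vectors with nonnegative coefficients, one of them positive. The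
-- identities are the two coordinates of the relation in four arrangements, with the positive term
-- first.
cross-relation : ∀ {x y z} → LexPos x → LexPos y → LexPos z → SignRelation (x ⨯ y) (x ⨯ z) (y ⨯ z)
cross-relation {x@(x₁ , x₂)} {y@(y₁ , y₂)} {z@(z₁ , z₂)} px py pz =
  (λ a c → ℚₚ.≰⇒> λ b → lexPos-combination≢0 pz py px a (p≤0⇒0≤-p b) c (r₁ x₁ x₂ y₁ y₂ z₁ z₂) (r₂ x₁ x₂ y₁ y₂ z₁ z₂)) ,
  (λ a c → ℚₚ.≰⇒> λ b → lexPos-combination≢0 px py pz c (p≤0⇒0≤-p b) a (r₃ x₁ x₂ y₁ y₂ z₁ z₂) (r₄ x₁ x₂ y₁ y₂ z₁ z₂)) ,
  (λ a c → ℚₚ.≰⇒> λ b → lexPos-combination≢0 pz py px (p<0⇒0<-p a) b (p≤0⇒0≤-p c) (r₅ x₁ x₂ y₁ y₂ z₁ z₂) (r₆ x₁ x₂ y₁ y₂ z₁ z₂)) ,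
  (λ a c → ℚₚ.≰⇒> λ b → lexPos-combination≢0 px py pz (p<0⇒0<-p c) b (p≤0⇒0≤-p a) (r₇ x₁ x₂ y₁ y₂ z₁ z₂) (r₈ x₁ x₂ y₁ y₂ z₁ z₂))
  where
  r₁ : ∀ x₁ x₂ y₁ y₂ z₁ z₂ → (x₁ * y₂ - x₂ * y₁) * z₁ + - (x₁ * z₂ - x₂ * z₁) * y₁ + (y₁ * z₂ - y₂ * z₁) * x₁ ≡ 0ℚ
  r₁ = solve-∀ ℚ-ring
  r₂ : ∀ x₁ x₂ y₁ y₂ z₁ z₂ → (x₁ * y₂ - x₂ * y₁) * z₂ + - (x₁ * z₂ - x₂ * z₁) * y₂ + (y₁ * z₂ - y₂ * z₁) * x₂ ≡ 0ℚ
  r₂ = solve-∀ ℚ-ring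
  r₃ : ∀ x₁ x₂ y₁ y₂ z₁ z₂ → (y₁ * z₂ - y₂ * z₁) * x₁ + - (x₁ * z₂ - x₂ * z₁) * y₁ + (x₁ * y₂ - x₂ * y₁) * z₁ ≡ 0ℚ
  r₃ = solve-∀ ℚ-ring
  r₄ : ∀ x₁ x₂ y₁ y₂ z₁ z₂ → (y₁ * z₂ - y₂ * z₁) * x₂ + - (x₁ * z₂ - x₂ * z₁) * y₂ + (x₁ * y₂ - x₂ * y₁) * z₂ ≡ 0ℚ
  r₄ = solve-∀ ℚ-ring
  r₅ : ∀ x₁ x₂ y₁ y₂ z₁ z₂ → - (x₁ * y₂ - x₂ * y₁) * z₁ + (x₁ * z₂ - x₂ * z₁) * y₁ + - (y₁ * z₂ - y₂ * z₁) * x₁ ≡ 0ℚ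
  r₅ = solve-∀ ℚ-ring
  r₆ : ∀ x₁ x₂ y₁ y₂ z₁ z₂ → - (x₁ * y₂ - x₂ * y₁) * z₂ + (x₁ * z₂ - x₂ * z₁) * y₂ + - (y₁ * z₂ - y₂ * z₁) * x₂ ≡ 0ℚ
  r₆ = solve-∀ ℚ-ring
  r₇ : ∀ x₁ x₂ y₁ y₂ z₁ z₂ → - (y₁ * z₂ - y₂ * z₁) * x₁ + (x₁ * z₂ - x₂ * z₁) * y₁ + - (x₁ * y₂ - x₂ * y₁) * z₁ ≡ 0ℚ
  r₇ = solve-∀ ℚ-ring
  r₈ : ∀ x₁ x₂ y₁ y₂ z₁ z₂ → - (y₁ * z₂ - y₂ * z₁) * x₂ + (x₁ * z₂ - x₂ * z₁) * y₂ + - (x₁ * y₂ - x₂ * y₁) * z₂ ≡ 0ℚ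
  r₈ = solve-∀ ℚ-ring

0<-p⇒p<0 : ∀ {p} → 0ℚ < - p → p < 0ℚ
0<-p⇒p<0 {p} h = subst (_< 0ℚ) (e p) (ℚₚ.neg-antimono-< h)
  where
  e : ∀ p → - (- p) ≡ p
  e = solve-∀ ℚ-ring

p≤0∧p≢0⇒p<0 : ∀ {p} → p ≤ 0ℚ → p ≢ 0ℚ → p < 0ℚ
p≤0∧p≢0⇒p<0 p≤0 p≢0 = ℚₚ.≰⇒> λ 0≤p → p≢0 (ℚₚ.≤-antisym p≤0 0≤p)

cross-left : ∀ p₁ p₂ a₁ a₂ b₁ b₂ q₁ q₂ → (a₁ - p₁) * (q₂ - a₂) - (a₂ - p₂) * (q₁ - a₁) ≡
  ((a₁ - p₁) * (b₂ - a₂) - (a₂ - p₂) * (b₁ - a₁)) + ((a₁ - p₁) * (q₂ - b₂) - (a₂ - p₂) * (q₁ - b₁))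
cross-left = solve-∀ ℚ-ring

cross-right : ∀ p₁ p₂ a₁ a₂ b₁ b₂ q₁ q₂ → (b₁ - p₁) * (q₂ - b₂) - (b₂ - p₂) * (q₁ - b₁) ≡
  ((a₁ - p₁) * (q₂ - b₂) - (a₂ - p₂) * (q₁ - b₁)) + ((b₁ - a₁) * (q₂ - b₂) - (b₂ - a₂) * (q₁ - b₁))
cross-right = solve-∀ ℚ-ring

-- For `p ≺ v ≺ q`, a left turn at `v` means that `v` lies strictly under the segment `pq`.
-- Collinear points count as not below.
below : Point → Point → Point → Bool
below p v q = isPos ((v ⊖ p) ⨯ (q ⊖ v))

-- Here `α + β` and `β + γ` tell the sides of `a` and `b` with respect to `pq`. The conclusion makes
-- the determinant `α - γ` positive and yields the remaining signs that `crossing-nested` asks for.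
nested-signs : ∀ {α β γ} → SignRelation α β γ → 0ℚ < α + β → β + γ ≤ 0ℚ → 0ℚ < α × γ ≤ 0ℚ
nested-signs {α} {β} {γ} (r₁ , r₂ , r₃ , r₄) h h' = α>0 , ℚₚ.≮⇒≥ ¬γ>0
  where
  e : ∀ α β → α + β + - α ≡ β
  e = solve-∀ ℚ-ring
  e' : ∀ β γ → - (β + γ) + β ≡ - γ
  e' = solve-∀ ℚ-ring
  α>0 : 0ℚ < α
  α>0 = ℚₚ.≰⇒> λ α≤0 →
    let β>0 = subst (0ℚ <_) (e α β) (0<p+q h (p≤0⇒0≤-p α≤0))
        -γ>0 = subst (0ℚ <_) (e' β γ) (ℚₚ.+-mono-≤-< (p≤0⇒0≤-p h') β>0)
    in ℚₚ.<-asym β>0 (r₄ α≤0 (0<-p⇒p<0 -γ>0))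
  ¬γ>0 : ¬ 0ℚ < γ
  ¬γ>0 γ>0 = ℚₚ.<-irrefl refl (ℚₚ.<-≤-trans (0<p+q (r₁ α>0 (ℚₚ.<⇒≤ γ>0)) (ℚₚ.<⇒≤ γ>0)) h')

-- Both `a` and `b` lie in the range spanned by `pq`, so if they were on different sides of it, `ab`
-- would have to cross `pq`.
nested-same-side : ∀ p a b q → p ≺ a → a ≺ b → b ≺ q → DisjointSegs p q a b →
  below p a q ≡ below p b q
nested-same-side p@(p₁ , p₂) a@(a₁ , a₂) b@(b₁ , b₂) q@(q₁ , q₂) x+ y+ z+ d
  with below p a q in ea | below p b q in eb
... | true  | true  = refl
... | false | false = refl
... | true  | false = ⊥-elim (meet (nested-signs rel α+β>0 β+γ≤0))
  where
  α = (a ⊖ p) ⨯ (b ⊖ a)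
  β = (a ⊖ p) ⨯ (q ⊖ b)
  γ = (b ⊖ a) ⨯ (q ⊖ b)
  rel = cross-relation {a ⊖ p} {b ⊖ a} {q ⊖ b} x+ y+ z+
  α+β>0 : 0ℚ < α + β
  α+β>0 = subst (0ℚ <_) (cross-left p₁ p₂ a₁ a₂ b₁ b₂ q₁ q₂) (isPos-true ea)
  β+γ≤0 : β + γ ≤ 0ℚ
  β+γ≤0 = subst (_≤ 0ℚ) (cross-right p₁ p₂ a₁ a₂ b₁ b₂ q₁ q₂) (isPos-false eb)
  meet : 0ℚ < α × γ ≤ 0ℚ → ⊥
  meet (α>0 , γ≤0) with 0<p⇒p-invertible (0<p+q α>0 (p≤0⇒0≤-p γ≤0))
  ... | δ , δ>0 , k = crossing-nested p a b q δ k
    (0≤p*q (ℚₚ.<⇒≤ α>0) (ℚₚ.<⇒≤ δ>0)) (0≤p*q (p≤0⇒0≤-p γ≤0) (ℚₚ.<⇒≤ δ>0))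
    (0≤p*q (ℚₚ.<⇒≤ α+β>0) (ℚₚ.<⇒≤ δ>0)) (0≤p*q (p≤0⇒0≤-p β+γ≤0) (ℚₚ.<⇒≤ δ>0)) d
-- The opposite orientation: the determinant `α - γ` is negative now, so its inverse is `- r`.
... | false | true  = ⊥-elim (meet (nested-signs (signRelation-sym rel) γ+β>0 β+α≤0))
  where
  α = (a ⊖ p) ⨯ (b ⊖ a)
  β = (a ⊖ p) ⨯ (q ⊖ b)
  γ = (b ⊖ a) ⨯ (q ⊖ b)
  rel = cross-relation {a ⊖ p} {b ⊖ a} {q ⊖ b} x+ y+ z+
  γ+β>0 : 0ℚ < γ + β
  γ+β>0 = subst (0ℚ <_) (trans (cross-right p₁ p₂ a₁ a₂ b₁ b₂ q₁ q₂) (ℚₚ.+-comm β γ)) (isPos-true eb)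
  β+α≤0 : β + α ≤ 0ℚ
  β+α≤0 = subst (_≤ 0ℚ) (trans (cross-left p₁ p₂ a₁ a₂ b₁ b₂ q₁ q₂) (ℚₚ.+-comm α β)) (isPos-false ea)
  e₀ : ∀ α γ r → (γ + - α) * r ≡ (α - γ) * - r
  e₀ = solve-∀ ℚ-ring
  e₁ : ∀ α r → - α * r ≡ α * - r
  e₁ = solve-∀ ℚ-ring
  e₂ : ∀ γ r → γ * r ≡ - γ * - r
  e₂ = solve-∀ ℚ-ring
  e₃ : ∀ α β r → - (β + α) * r ≡ (α + β) * - r
  e₃ = solve-∀ ℚ-ring
  e₄ : ∀ β γ r → (γ + β) * r ≡ - (β + γ) * - r
  e₄ = solve-∀ ℚ-ring
  meet : 0ℚ < γ × α ≤ 0ℚ → ⊥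
  meet (γ>0 , α≤0) with 0<p⇒p-invertible (0<p+q γ>0 (p≤0⇒0≤-p α≤0))
  ... | r , r>0 , k = crossing-nested p a b q (- r) (trans (sym (e₀ α γ r)) k)
    (subst (0ℚ ≤_) (e₁ α r) (0≤p*q (p≤0⇒0≤-p α≤0) (ℚₚ.<⇒≤ r>0)))
    (subst (0ℚ ≤_) (e₂ γ r) (0≤p*q (ℚₚ.<⇒≤ γ>0) (ℚₚ.<⇒≤ r>0)))
    (subst (0ℚ ≤_) (e₃ α β r) (0≤p*q (p≤0⇒0≤-p β+α≤0) (ℚₚ.<⇒≤ r>0)))
    (subst (0ℚ ≤_) (e₄ β γ r) (0≤p*q (ℚₚ.<⇒≤ γ+β>0) (ℚₚ.<⇒≤ r>0))) d

-- Over the common range from `a` to `q` one segment stays under the other. If the two tests agreed,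
-- all three cross products would have the same sign and the segments would cross.
interleaved-opposite-sides : ∀ p a q b → p ≺ a → a ≺ q → q ≺ b → DisjointSegs p q a b →
  below p a q ≡ not (below a q b)
interleaved-opposite-sides p a q b x+ y+ z+ d with below p a q in ea | below a q b in eb
... | true  | false = refl
... | false | true  = refl
... | true  | true  = ⊥-elim (meet (0<p⇒p-invertible (0<p+q (0<p+q α>0 (ℚₚ.<⇒≤ β>0)) (ℚₚ.<⇒≤ γ>0))))
  where
  α = (a ⊖ p) ⨯ (q ⊖ a)
  β = (a ⊖ p) ⨯ (b ⊖ q)
  γ = (q ⊖ a) ⨯ (b ⊖ q)
  α>0 : 0ℚ < α
  α>0 = isPos-true ea
  γ>0 : 0ℚ < γ
  γ>0 = isPos-true eb
  β>0 : 0ℚ < β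
  β>0 = proj₁ (cross-relation {a ⊖ p} {q ⊖ a} {b ⊖ q} x+ y+ z+) α>0 (ℚₚ.<⇒≤ γ>0)
  meet : (Σ ℚ λ r → 0ℚ < r × (α + β + γ) * r ≡ 1ℚ) → ⊥
  meet (r , r>0 , k) = crossing-interleaved p a q b r k
    (0≤p*q (ℚₚ.<⇒≤ α>0) (ℚₚ.<⇒≤ r>0)) (0≤p*q (ℚₚ.<⇒≤ β>0) (ℚₚ.<⇒≤ r>0)) (0≤p*q (ℚₚ.<⇒≤ γ>0) (ℚₚ.<⇒≤ r>0)) d
... | false | false = ⊥-elim (meet (0<p⇒p-invertible (0<p+q (0<p+q -α>0 (ℚₚ.<⇒≤ -β>0)) (ℚₚ.<⇒≤ -γ>0))))
  where
  α = (a ⊖ p) ⨯ (q ⊖ a)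
  β = (a ⊖ p) ⨯ (b ⊖ q)
  γ = (q ⊖ a) ⨯ (b ⊖ q)
  -- A zero of `α` would put `a` on `pq`, and a zero of `γ` would put `q` on `ab`. Disjointness
  -- therefore turns the weak inequalities into strict ones.
  -α>0 : 0ℚ < - α
  -α>0 = p<0⇒0<-p (p≤0∧p≢0⇒p<0 (isPos-false ea)
    (λ α≡0 → d a (collinear-between p a q x+ y+ α≡0) (onSeg-start a b)))
  -γ>0 : 0ℚ < - γ
  -γ>0 = p<0⇒0<-p (p≤0∧p≢0⇒p<0 (isPos-false eb)
    (λ γ≡0 → d q (onSeg-end p q) (collinear-between a q b y+ z+ γ≡0)))
  -β>0 : 0ℚ < - β
  -β>0 = p<0⇒0<-p (proj₁ (proj₂ (proj₂ (cross-relation {a ⊖ p} {q ⊖ a} {b ⊖ q} x+ y+ z+)))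
    (0<-p⇒p<0 -α>0) (isPos-false eb))
  e₀ : ∀ α β γ r → (- α + - β + - γ) * r ≡ (α + β + γ) * - r
  e₀ = solve-∀ ℚ-ring
  e₁ : ∀ α r → - α * r ≡ α * - r
  e₁ = solve-∀ ℚ-ring
  meet : (Σ ℚ λ r → 0ℚ < r × (- α + - β + - γ) * r ≡ 1ℚ) → ⊥
  meet (r , r>0 , k) = crossing-interleaved p a q b (- r) (trans (sym (e₀ α β γ r)) k)
    (subst (0ℚ ≤_) (e₁ α r) (0≤p*q (ℚₚ.<⇒≤ -α>0) (ℚₚ.<⇒≤ r>0)))
    (subst (0ℚ ≤_) (e₁ β r) (0≤p*q (ℚₚ.<⇒≤ -β>0) (ℚₚ.<⇒≤ r>0)))
    (subst (0ℚ ≤_) (e₁ γ r) (0≤p*q (ℚₚ.<⇒≤ -γ>0) (ℚₚ.<⇒≤ r>0))) d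

-- Linking of polygonal arcs mod 2

-- Whether the vertical ray upwards from v meets pq, for v pushed off the verticals by the lexicographic order.
above : Point → Point → Point → Bool
above p q v = (lt p v ∧ lt v q ∧ below p v q) xor (lt q v ∧ lt v p ∧ below q v p)

above-sym : ∀ p q v → above p q v ≡ above q p v
above-sym p q v = xor-comm (lt p v ∧ lt v q ∧ below p v q) (lt q v ∧ lt v p ∧ below q v p)

-- over v is the parity of the number of times the arc passes above v.
record Arc : Set where
  constructor arc
  field
    start end : Point
    over      : Point → Bool
open Arc

-- The parity of the number of times the vector from the second arc to the first crosses the upward vertical
-- along the boundary of the product of the two arcs; passing below v is expressed by passing above v and the order.
linking : Arc → Arc → Bool
linking (arc p q A) (arc a b B) =
  ((A a xor A b) xor (B p xor B q)) xor ((lt a p xor lt b p) xor (lt a q xor lt b q))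

seg : Point → Point → Arc
seg p q = arc p q (above p q)

reverse : Arc → Arc
reverse (arc p q A) = arc q p A

linking-reverseˡ : ∀ X Y → linking (reverse X) Y ≡ linking X Y
linking-reverseˡ (arc p q A) (arc a b B) =
  cong₂ (λ u v → ((A a xor A b) xor u) xor v) (xor-comm (B q) (B p)) (xor-comm (lt a q xor lt b q) _)

linking-reverseʳ : ∀ X Y → linking X (reverse Y) ≡ linking X Y
linking-reverseʳ (arc p q A) (arc a b B) =
  cong₂ _xor_ (cong (_xor (B p xor B q)) (xor-comm (A b) (A a)))
    (cong₂ _xor_ (xor-comm (lt b p) (lt a p)) (xor-comm (lt b q) (lt a q)))

infixr 5 _∙_
_∙_ : Arc → Arc → Arc
arc p q A ∙ arc q' r B = arc p r (λ v → A v xor B v)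

-- The terms at the common end point occur in both summands and cancel mod 2.
linking-∙ˡ : ∀ X Y Z → end X ≡ start Y → linking (X ∙ Y) Z ≡ linking X Z xor linking Y Z
linking-∙ˡ (arc p q A) (arc _ r A') (arc a b B) refl =
  solve 13 (λ Aa Ab A'a A'b Bp Bq Br ap bp aq bq ar br →
    (((Aa :+ A'a) :+ (Ab :+ A'b)) :+ (Bp :+ Br)) :+ ((ap :+ bp) :+ (ar :+ br)) :=
    (((Aa :+ Ab) :+ (Bp :+ Bq)) :+ ((ap :+ bp) :+ (aq :+ bq))) :+
    (((A'a :+ A'b) :+ (Bq :+ Br)) :+ ((aq :+ bq) :+ (ar :+ br)))) refl
    (A a) (A b) (A' a) (A' b) (B p) (B q) (B r) (lt a p) (lt b p) (lt a q) (lt b q) (lt a r) (lt b r)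
  where open xor-∧-Solver

linking-∙ʳ : ∀ X Y Z → end Y ≡ start Z → linking X (Y ∙ Z) ≡ linking X Y xor linking X Z
linking-∙ʳ (arc p q A) (arc a b B) (arc _ c C) refl =
  solve 13 (λ Aa Ab Ac Bp Bq Cp Cq ap bp cp aq bq cq →
    (((Aa :+ Ac) :+ ((Bp :+ Cp) :+ (Bq :+ Cq))) :+ ((ap :+ cp) :+ (aq :+ cq))) :=
    (((Aa :+ Ab) :+ (Bp :+ Bq)) :+ ((ap :+ bp) :+ (aq :+ bq))) :+
    (((Ab :+ Ac) :+ (Cp :+ Cq)) :+ ((bp :+ cp) :+ (bq :+ cq)))) refl
    (A a) (A b) (A c) (B p) (B q) (C p) (C q) (lt a p) (lt b p) (lt c p) (lt a q) (lt b q) (lt c q)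
  where open xor-∧-Solver

-- Exchanging the arcs negates each of the four comparisons, and an even number of negations
-- cancels. The hypotheses exclude ties.
linking-sym : ∀ X Y → start Y ≢ start X → end Y ≢ start X → start Y ≢ end X → end Y ≢ end X →
  linking Y X ≡ linking X Y
linking-sym (arc p q A) (arc a b B) ap bp aq bq =
  flip (A a) (A b) (B p) (B q) (lt-not {p} {a} (≢-sym ap)) (lt-not {p} {b} (≢-sym bp))
    (lt-not {q} {a} (≢-sym aq)) (lt-not {q} {b} (≢-sym bq))
  where
  open xor-∧-Solver
  flip : ∀ Aa Ab Bp Bq {ap bp aq bq pa pb qa qb} → pa ≡ not ap → pb ≡ not bp → qa ≡ not aq → qb ≡ not bq →
    ((Bp xor Bq) xor (Aa xor Ab)) xor ((pa xor qa) xor (pb xor qb)) ≡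
    ((Aa xor Ab) xor (Bp xor Bq)) xor ((ap xor bp) xor (aq xor bq))
  flip Aa Ab Bp Bq {ap} {bp} {aq} {bq} refl refl refl refl =
    solve 8 (λ Aa Ab Bp Bq ap bp aq bq →
      ((Bp :+ Bq) :+ (Aa :+ Ab)) :+
        (((con true :+ ap) :+ (con true :+ aq)) :+ ((con true :+ bp) :+ (con true :+ bq))) :=
      ((Aa :+ Ab) :+ (Bp :+ Bq)) :+ ((ap :+ bp) :+ (aq :+ bq))) refl Aa Ab Bp Bq ap bp aq bq

-- The truth values are kept abstract because comparisons of rational points are expensive to normalise.
linkingᵇ : (pa ap pb bp qa aq qb bq paq qap pbq qbp apb bpa aqb bqa : Bool) → Bool
linkingᵇ pa ap pb bp qa aq qb bq paq qap pbq qbp apb bpa aqb bqa =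
  ((((pa ∧ aq ∧ paq) xor (qa ∧ ap ∧ qap)) xor ((pb ∧ bq ∧ pbq) xor (qb ∧ bp ∧ qbp))) xor
   (((ap ∧ pb ∧ apb) xor (bp ∧ pa ∧ bpa)) xor ((aq ∧ qb ∧ aqb) xor (bq ∧ qa ∧ bqa)))) xor
  ((ap xor bp) xor (aq xor bq))

-- Neither segment spans an end point of the other, and the four comparisons are all false.
linking-separated : ∀ p q a b → p ≺ q → q ≺ a → a ≺ b → linking (seg p q) (seg a b) ≡ false
linking-separated p q a b pq qa ab =
  eval (≺⇒lt {p} {a} pa) (≺⇒gt {p} {a} pa) (≺⇒lt {p} {b} pb) (≺⇒gt {p} {b} pb)
    (≺⇒lt {q} {a} qa) (≺⇒gt {q} {a} qa) (≺⇒lt {q} {b} qb) (≺⇒gt {q} {b} qb)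
    (below p a q) (below q a p) (below p b q) (below q b p) (below a p b) (below b p a) (below a q b) (below b q a)
  where
  pa = ≺-trans {p} {q} {a} pq qa
  qb = ≺-trans {q} {a} {b} qa ab
  pb = ≺-trans {p} {q} {b} pq qb
  eval : ∀ {pa ap pb bp qa aq qb bq} → pa ≡ true → ap ≡ false → pb ≡ true → bp ≡ false →
    qa ≡ true → aq ≡ false → qb ≡ true → bq ≡ false → ∀ paq qap pbq qbp apb bpa aqb bqa →
    linkingᵇ pa ap pb bp qa aq qb bq paq qap pbq qbp apb bpa aqb bqa ≡ false
  eval refl refl refl refl refl refl refl refl _ _ _ _ _ _ _ _ = refl

-- Only `pq` spans end points of the other segment. What remains is the difference between the sides
-- of `a` and `b`, since the two true comparisons cancel.
linking-nested : ∀ p a b q → p ≺ a → a ≺ b → b ≺ q → DisjointSegs p q a b → linking (seg p q) (seg a b) ≡ false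
linking-nested p a b q pa ab bq d =
  eval (≺⇒lt {p} {a} pa) (≺⇒gt {p} {a} pa) (≺⇒lt {p} {b} pb) (≺⇒gt {p} {b} pb)
    (≺⇒gt {a} {q} aq) (≺⇒lt {a} {q} aq) (≺⇒gt {b} {q} bq) (≺⇒lt {b} {q} bq)
    (below p a q) (below q a p) (below p b q) (below q b p) (below a p b) (below b p a) (below a q b) (below b q a)
    (nested-same-side p a b q pa ab bq d)
  where
  pb = ≺-trans {p} {a} {b} pa ab
  aq = ≺-trans {a} {b} {q} ab bq
  eval : ∀ {pa ap pb bp qa aq qb bq} → pa ≡ true → ap ≡ false → pb ≡ true → bp ≡ false →
    qa ≡ false → aq ≡ true → qb ≡ false → bq ≡ true → ∀ paq qap pbq qbp apb bpa aqb bqa → paq ≡ pbq →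
    linkingᵇ pa ap pb bp qa aq qb bq paq qap pbq qbp apb bpa aqb bqa ≡ false
  eval refl refl refl refl refl refl refl refl true  _ _ _ _ _ _ _ refl = refl
  eval refl refl refl refl refl refl refl refl false _ _ _ _ _ _ _ refl = refl

-- Only `a` under or over `pq` and `q` under or over `ab` contribute. The one true comparison,
-- `a ≺ q`, accounts for the negation.
linking-interleaved : ∀ p a q b → p ≺ a → a ≺ q → q ≺ b → DisjointSegs p q a b → linking (seg p q) (seg a b) ≡ false
linking-interleaved p a q b pa aq qb d =
  eval (≺⇒lt {p} {a} pa) (≺⇒gt {p} {a} pa) (≺⇒lt {p} {b} pb) (≺⇒gt {p} {b} pb)
    (≺⇒gt {a} {q} aq) (≺⇒lt {a} {q} aq) (≺⇒lt {q} {b} qb) (≺⇒gt {q} {b} qb)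
    (below p a q) (below q a p) (below p b q) (below q b p) (below a p b) (below b p a) (below a q b) (below b q a)
    (interleaved-opposite-sides p a q b pa aq qb d)
  where
  pb = ≺-trans {p} {a} {b} pa (≺-trans {a} {q} {b} aq qb)
  eval : ∀ {pa ap pb bp qa aq qb bq} → pa ≡ true → ap ≡ false → pb ≡ true → bp ≡ false →
    qa ≡ false → aq ≡ true → qb ≡ true → bq ≡ false → ∀ paq qap pbq qbp apb bpa aqb bqa → paq ≡ not aqb →
    linkingᵇ pa ap pb bp qa aq qb bq paq qap pbq qbp apb bpa aqb bqa ≡ false
  eval refl refl refl refl refl refl refl refl _ _ _ _ _ _ true  _ refl = refl
  eval refl refl refl refl refl refl refl refl _ _ _ _ _ _ false _ refl = refl

disjointSegs-flipˡ : ∀ p q a b → DisjointSegs p q a b → DisjointSegs q p a b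
disjointSegs-flipˡ p q a b d x h = d x (onSeg-sym q p h)

disjointSegs-flipʳ : ∀ p q a b → DisjointSegs p q a b → DisjointSegs p q b a
disjointSegs-flipʳ p q a b d x h h' = d x h (onSeg-sym b a h')

disjointSegs-sym : ∀ p q a b → DisjointSegs p q a b → DisjointSegs a b p q
disjointSegs-sym p q a b d x h h' = d x h' h

-- Reversing either segment and exchanging the two sorts the four end points into one of the three
-- arrangements treated above.
linking-segs : ∀ p q a b → p ≢ q → a ≢ b → DisjointSegs p q a b → linking (seg p q) (seg a b) ≡ false
linking-segs p q a b p≢q a≢b d = sort p q a b p≢q a≢b d
  where
  Claim : Point → Point → Point → Point → Set
  Claim p q a b = DisjointSegs p q a b → linking (seg p q) (seg a b) ≡ false

  flipˡ : ∀ p q a b → Claim p q a b → Claim q p a b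
  flipˡ p q a b c d = trans (cong₂ (λ u v → ((u xor v) xor (above a b q xor above a b p)) xor
      ((lt a q xor lt b q) xor (lt a p xor lt b p))) (above-sym q p a) (above-sym q p b))
    (trans (linking-reverseˡ (seg p q) (seg a b)) (c (disjointSegs-flipˡ q p a b d)))

  flipʳ : ∀ p q a b → Claim p q a b → Claim p q b a
  flipʳ p q a b c d = trans (cong₂ (λ u v → ((above p q b xor above p q a) xor (u xor v)) xor
      ((lt b p xor lt a p) xor (lt b q xor lt a q))) (above-sym b a p) (above-sym b a q))
    (trans (linking-reverseʳ (seg p q) (seg a b)) (c (disjointSegs-flipʳ p q b a d)))

  swap : ∀ p q a b → Claim p q a b → Claim a b p q
  swap p q a b c d = trans (linking-sym (seg p q) (seg a b)
      (λ { refl → d a (onSeg-start a b) (onSeg-start a q) }) (λ { refl → d b (onSeg-end a b) (onSeg-start b q) })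
      (λ { refl → d a (onSeg-start a b) (onSeg-end p a) }) (λ { refl → d b (onSeg-end a b) (onSeg-end p b) }))
    (c (disjointSegs-sym a b p q d))

  sorted : ∀ p q a b → p ≺ q → a ≺ b → p ≺ a → Claim p q a b
  sorted p q a b pq ab pa d with ≺-connex {q} {a} (λ { refl → d q (onSeg-end p q) (onSeg-start q b) })
  ... | inj₁ qa = linking-separated p q a b pq qa ab
  ... | inj₂ aq with ≺-connex {q} {b} (λ { refl → d q (onSeg-end p q) (onSeg-end a q) })
  ...   | inj₁ qb = linking-interleaved p a q b pa aq qb d
  ...   | inj₂ bq = linking-nested p a b q pa ab bq d

  sort₂ : ∀ p q a b → p ≺ q → a ≺ b → Claim p q a b
  sort₂ p q a b pq ab d with ≺-connex {p} {a} (λ { refl → d p (onSeg-start p q) (onSeg-start p b) })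
  ... | inj₁ pa = sorted p q a b pq ab pa d
  ... | inj₂ ap = swap a b p q (sorted a b p q ab pq ap) d

  sort₁ : ∀ p q a b → p ≺ q → a ≢ b → Claim p q a b
  sort₁ p q a b pq a≢b with ≺-connex a≢b
  ... | inj₁ ab = sort₂ p q a b pq ab
  ... | inj₂ ba = flipʳ p q b a (sort₂ p q b a pq ba)

  sort : ∀ p q a b → p ≢ q → a ≢ b → Claim p q a b
  sort p q a b p≢q a≢b with ≺-connex p≢q
  ... | inj₁ pq = sort₁ p q a b pq a≢b
  ... | inj₂ qp = flipˡ q p a b (sort₁ q p a b qp a≢b)

-- Arcs composed of pieces

data Chain (S : Arc → Set) : Arc → Set where
  nil  : ∀ p → Chain S (arc p p (λ _ → false))
  link : ∀ {X} → S X → Chain S X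
  join : ∀ {X Y} → end X ≡ start Y → Chain S X → Chain S Y → Chain S (X ∙ Y)
  rev  : ∀ {X} → Chain S X → Chain S (reverse X)

linking-nilˡ : ∀ p Y → linking (arc p p (λ _ → false)) Y ≡ false
linking-nilˡ p (arc a b B) = cong₂ _xor_ (xor-same (B p)) (xor-same (lt a p xor lt b p))

linking-nilʳ : ∀ X a → linking X (arc a a (λ _ → false)) ≡ false
linking-nilʳ (arc p q A) a = cong₂ _xor_ (cong (_xor false) (xor-same (A a))) (cong₂ _xor_ (xor-same (lt a p)) (xor-same (lt a q)))

-- The linking is additive in each argument and insensitive to reversal, so its vanishing on pieces
-- extends to chains. This serves first for the segments of two edges and then for the edges of two
-- walks.
linking-chains : ∀ {S T} → (∀ {X Y} → S X → T Y → linking X Y ≡ false) →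
  ∀ {X Y} → Chain S X → Chain T Y → linking X Y ≡ false
linking-chains {S} {T} z = go
  where
  goʳ : ∀ {X Y} → S X → Chain T Y → linking X Y ≡ false
  goʳ {X} s (nil a)  = linking-nilʳ X a
  goʳ s (link t)     = z s t
  goʳ {X} s (join {Y} {Z} e c c') = trans (linking-∙ʳ X Y Z e) (cong₂ _xor_ (goʳ s c) (goʳ s c'))
  goʳ {X} s (rev {Y} c) = trans (linking-reverseʳ X Y) (goʳ s c)
  go : ∀ {X Y} → Chain S X → Chain T Y → linking X Y ≡ false
  go {Y = Y} (nil p) _ = linking-nilˡ p Y
  go (link s) d        = goʳ s d
  go {Y = Z} (join {X} {Y} e c c') d = trans (linking-∙ˡ X Y Z e) (cong₂ _xor_ (go c d) (go c' d))
  go {Y = Y} (rev {X} c) d = trans (linking-reverseˡ X Y) (go c d)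

-- Sum of the two relations for a 4-cycle. The comparison of `x` with `x'` cancels, while `y₀` and
-- `y₁` are compared once in each order, which produces the 1.
linking-pair : ∀ x x' y₀ y₁ A₀ A₁ B₀ B₁ → y₀ ≢ y₁ →
  linking (arc x y₀ A₀) (arc x' y₁ B₁) ≡ false → linking (arc x y₁ A₁) (arc x' y₀ B₀) ≡ false →
  (((A₀ x' xor lt x' y₀) xor (B₀ x xor lt y₀ x)) xor ((A₁ x' xor lt x' y₁) xor (B₁ x xor lt y₁ x))) xor
  ((A₀ y₁ xor A₁ y₀) xor (B₀ y₁ xor B₁ y₀)) ≡ true
linking-pair x x' y₀ y₁ A₀ A₁ B₀ B₁ y₀≢y₁ e e' =
  combine (A₀ x') (A₁ x') (B₀ x) (B₁ x) (A₀ y₁) (A₁ y₀) (B₀ y₁) (B₁ y₀)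
    (lt x' x) (lt y₀ x) (lt y₁ x) (lt x' y₀) (lt x' y₁) (lt y₀ y₁) (lt-not {y₁} {y₀} (≢-sym y₀≢y₁)) e e'
  where
  open xor-∧-Solver
  combine : ∀ A₀x' A₁x' B₀x B₁x A₀y₁ A₁y₀ B₀y₁ B₁y₀ x'x y₀x y₁x x'y₀ x'y₁ y₀y₁ {y₁y₀} → y₁y₀ ≡ not y₀y₁ →
    ((A₀x' xor A₀y₁) xor (B₁x xor B₁y₀)) xor ((x'x xor y₁x) xor (x'y₀ xor y₁y₀)) ≡ false →
    ((A₁x' xor A₁y₀) xor (B₀x xor B₀y₁)) xor ((x'x xor y₀x) xor (x'y₁ xor y₀y₁)) ≡ false →
    (((A₀x' xor x'y₀) xor (B₀x xor y₀x)) xor ((A₁x' xor x'y₁) xor (B₁x xor y₁x))) xor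
    ((A₀y₁ xor A₁y₀) xor (B₀y₁ xor B₁y₀)) ≡ true
  combine A₀x' A₁x' B₀x B₁x A₀y₁ A₁y₀ B₀y₁ B₁y₀ x'x y₀x y₁x x'y₀ x'y₁ y₀y₁ refl e e' =
    trans (solve 14 (λ A₀x' A₁x' B₀x B₁x A₀y₁ A₁y₀ B₀y₁ B₁y₀ x'x y₀x y₁x x'y₀ x'y₁ y₀y₁ →
      (((A₀x' :+ x'y₀) :+ (B₀x :+ y₀x)) :+ ((A₁x' :+ x'y₁) :+ (B₁x :+ y₁x))) :+
        ((A₀y₁ :+ A₁y₀) :+ (B₀y₁ :+ B₁y₀)) :=
      (con true :+ (((A₀x' :+ A₀y₁) :+ (B₁x :+ B₁y₀)) :+ ((x'x :+ y₁x) :+ (x'y₀ :+ (con true :+ y₀y₁))))) :+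
        (((A₁x' :+ A₁y₀) :+ (B₀x :+ B₀y₁)) :+ ((x'x :+ y₀x) :+ (x'y₁ :+ y₀y₁)))) refl
      A₀x' A₁x' B₀x B₁x A₀y₁ A₁y₀ B₀y₁ B₁y₀ x'x y₀x y₁x x'y₀ x'y₁ y₀y₁)
    (cong₂ (λ u v → (true xor u) xor v) e e')

-- Each of `a`, `b`, `c` occurs twice and cancels, and three ones add up to one.
xor-triangle : ∀ a b c u v w → (a xor b) xor u ≡ true → (b xor c) xor v ≡ true → (a xor c) xor w ≡ true →
  (u xor v) xor w ≡ true
xor-triangle a b c u v w e₁ e₂ e₃ = trans (solve 6 (λ a b c u v w →
  (u :+ v) :+ w := (((a :+ b) :+ u) :+ ((b :+ c) :+ v)) :+ ((a :+ c) :+ w)) refl a b c u v w)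
  (cong₂ _xor_ (cong₂ _xor_ e₁ e₂) e₃)
  where open xor-∧-Solver

-- A j (y j′) tells whether the arc from x to y j passes above y j′; the sum over j ≢ j′ is taken mod 2.
starCrossings : (Fin 3 → Point) → (Fin 3 → Point → Bool) → Bool
starCrossings y A =
  ((A 0F (y 1F) xor A 1F (y 0F)) xor (A 1F (y 2F) xor A 2F (y 1F))) xor (A 0F (y 2F) xor A 2F (y 0F))

-- The terms involving `x` or `x'` are collected in `h j`. Each `h j` belongs to two of the three
-- pairs of indices, so summing `linking-pair` over the pairs leaves only the star crossings and an
-- odd number of ones.
starCrossings-differ : ∀ x x' (y : Fin 3 → Point) A B → (∀ i j → i ≢ j → y i ≢ y j) →
  (∀ i j → i ≢ j → linking (arc x (y i) (A i)) (arc x' (y j) (B j)) ≡ false) →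
  starCrossings y A xor starCrossings y B ≡ true
starCrossings-differ x x' y A B inj z = trans
  (rearrange (s A 0F 1F) (s A 1F 2F) (s A 0F 2F) (s B 0F 1F) (s B 1F 2F) (s B 0F 2F))
  (xor-triangle (h 0F) (h 1F) (h 2F) (s A 0F 1F xor s B 0F 1F) (s A 1F 2F xor s B 1F 2F) (s A 0F 2F xor s B 0F 2F)
    (pair 0F 1F (λ ())) (pair 1F 2F (λ ())) (pair 0F 2F (λ ())))
  where
  open xor-∧-Solver
  h : Fin 3 → Bool
  h j = (A j x' xor lt x' (y j)) xor (B j x xor lt (y j) x)
  s : (Fin 3 → Point → Bool) → Fin 3 → Fin 3 → Bool
  s C i j = C i (y j) xor C j (y i)
  pair : ∀ i j → i ≢ j → (h i xor h j) xor (s A i j xor s B i j) ≡ true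
  pair i j i≢j = linking-pair x x' (y i) (y j) (A i) (A j) (B i) (B j) (inj i j i≢j) (z i j i≢j) (z j i (≢-sym i≢j))
  rearrange : ∀ a b c a' b' c' →
    ((a xor b) xor c) xor ((a' xor b') xor c') ≡ ((a xor a') xor (b xor b')) xor (c xor c')
  rearrange = solve 6 (λ a b c a' b' c' →
    ((a :+ b) :+ c) :+ ((a' :+ b') :+ c') := ((a :+ a') :+ (b :+ b')) :+ (c :+ c')) refl

-- The star crossings of the three centres would be three pairwise different truth values.
K₃₃-linked : ∀ (x y : Fin 3 → Point) (A : Fin 3 → Fin 3 → Point → Bool) → (∀ i j → i ≢ j → y i ≢ y j) →
  ¬ (∀ i i' j j' → i ≢ i' → j ≢ j' → linking (arc (x i) (y j) (A i j)) (arc (x i') (y j') (A i' j')) ≡ false)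
K₃₃-linked x y A inj z = no-3 (starCrossings y (A 0F)) (starCrossings y (A 1F)) (starCrossings y (A 2F))
  (differ 0F 1F (λ ())) (differ 1F 2F (λ ())) (differ 0F 2F (λ ()))
  where
  differ : ∀ i i' → i ≢ i' → starCrossings y (A i) xor starCrossings y (A i') ≡ true
  differ i i' i≢i' = starCrossings-differ (x i) (x i') y (A i) (A i') inj (λ j j' → z i i' j j' i≢i')
  no-3 : ∀ a b c → a xor b ≡ true → b xor c ≡ true → a xor c ≡ true → ⊥
  no-3 true  false true  _ _ ()
  no-3 false true  false _ _ ()

chain-map : ∀ {S T} → (∀ {X} → S X → T X) → ∀ {X} → Chain S X → Chain T X
chain-map f (nil p)      = nil p
chain-map f (link s)     = link (f s)
chain-map f (join e c d) = join e (chain-map f c) (chain-map f d)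
chain-map f (rev c)      = rev (chain-map f c)

-- Drawings contain no K₃,₃ minor

polyArc : Point → List Point → Arc
polyArc p []       = arc p p (λ _ → false)
polyArc p (q ∷ qs) = seg p q ∙ polyArc q qs

start-polyArc : ∀ p qs → start (polyArc p qs) ≡ p
start-polyArc p []      = refl
start-polyArc p (_ ∷ _) = refl

end-polyArc : ∀ p qs q → end (polyArc p (qs ++ [ q ])) ≡ q
end-polyArc p [] q       = refl
end-polyArc p (r ∷ qs) q = end-polyArc r qs q

SegOf : List Point → Arc → Set
SegOf ps X = Σ (Fin (length (segs ps))) λ i → X ≡ seg (proj₁ (lookup (segs ps) i)) (proj₂ (lookup (segs ps) i))

polyArc-chain : ∀ p qs → Chain (SegOf (p ∷ qs)) (polyArc p qs)
polyArc-chain p []       = nil p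
polyArc-chain p (q ∷ qs) = join (sym (start-polyArc q qs)) (link (zero , refl))
  (chain-map (λ { (i , e) → suc i , e }) (polyArc-chain q qs))

module _ {G : Graph} (D : Drawing G) where
  open Drawing D

  -- The end points are those of the edge by definition, and only `over` is computed from the
  -- polygon. Edges can thus be composed into walks without transport.
  edgeArc : E G → Arc
  edgeArc e = arc (pos (src G e)) (pos (tgt G e)) (over (polyArc (pos (src G e)) (bends e ++ [ pos (tgt G e) ])))

  edgeArc-chain : ∀ e → Chain (SegOf (poly e)) (edgeArc e)
  edgeArc-chain e = subst (Chain (SegOf (poly e)))
    (cong₂ (λ p q → arc p q (over X)) (start-polyArc _ (bends e ++ [ pos (tgt G e) ])) (end-polyArc _ (bends e) _))
    (polyArc-chain _ (bends e ++ [ pos (tgt G e) ]))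
    where X = polyArc (pos (src G e)) (bends e ++ [ pos (tgt G e) ])

  End : E G → V G → Set
  End e v = v ≡ src G e ⊎ v ≡ tgt G e

  independent-disjoint : ∀ e f → (∀ v → End e v → End f v → ⊥) → ∀ x → OnPoly x (poly e) → OnPoly x (poly f) → ⊥
  -- If `f` were `e`, its source would be a common end.
  independent-disjoint e f ind x oe of with arcs-meet e f x (λ { refl → ind (src G e) (inj₁ refl) (inj₁ refl) }) oe of
  ... | v , refl = ind v (arc-avoids e v oe) (arc-avoids f v of)

  independent-unlinked : ∀ e f → (∀ v → End e v → End f v → ⊥) → linking (edgeArc e) (edgeArc f) ≡ false
  independent-unlinked e f ind = linking-chains
    (λ { (i , refl) (j , refl) → linking-segs _ _ _ _ (proj₁ (arc-simple e) i) (proj₁ (arc-simple f) j)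
           (λ x oi oj → independent-disjoint e f ind x (lose (∈-lookup i) oi) (lose (∈-lookup j) oj)) })
    (edgeArc-chain e) (edgeArc-chain f)

  -- Walks inside a set of vertices

  EdgeIn : (V G → Set) → Arc → Set
  EdgeIn P X = Σ (E G) λ e → P (src G e) × P (tgt G e) × X ≡ edgeArc e

  record Walk (P : V G → Set) (u v : V G) : Set where
    constructor walk
    field
      {over′} : Point → Bool
      chain   : Chain (EdgeIn P) (arc (pos u) (pos v) over′)
  open Walk public

  walk-refl : ∀ {P} v → Walk P v v
  walk-refl v = walk (nil (pos v))

  walk-edge : ∀ {P} e → P (src G e) → P (tgt G e) → Walk P (src G e) (tgt G e)
  walk-edge e p q = walk (link (e , p , q , refl))

  walk-trans : ∀ {P u v w} → Walk P u v → Walk P v w → Walk P u w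
  walk-trans (walk c) (walk d) = walk (join refl c d)

  walk-sym : ∀ {P u v} → Walk P u v → Walk P v u
  walk-sym (walk c) = walk (rev c)

  walk-line : ∀ {P n} (vtx : Fin (suc n) → V G) (edge : Fin n → E G) →
    (∀ i → src G (edge i) ≡ vtx (inject₁ i)) → (∀ i → tgt G (edge i) ≡ vtx (suc i)) →
    ∀ i j → i Fin.≤ j → (∀ m → i Fin.≤ m → m Fin.≤ j → P (vtx m)) → Walk P (vtx i) (vtx j)
  walk-line {P} {n} vtx edge es et i = <-weakInduction Q base step
    where
    Q : Fin (suc n) → Set
    Q j = i Fin.≤ j → (∀ m → i Fin.≤ m → m Fin.≤ j → P (vtx m)) → Walk P (vtx i) (vtx j)
    base : Q zero
    base i≤0 _ = subst (λ j → Walk P (vtx i) (vtx j)) (Finₚ.≤-antisym i≤0 ℕ.z≤n) (walk-refl (vtx i))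
    step : ∀ j → Q (inject₁ j) → Q (suc j)
    step j ih i≤j p with ℕₚ.m≤n⇒m<n∨m≡n i≤j
    ... | inj₂ e = subst (λ j → Walk P (vtx i) (vtx j)) (Finₚ.toℕ-injective e) (walk-refl (vtx i))
    ... | inj₁ (ℕ.s≤s i≤j') = walk-trans
      (ih i≤j″ (λ m i≤m m≤j → p m i≤m (ℕₚ.≤-trans m≤j (ℕₚ.≤-trans (ℕₚ.≤-reflexive (Finₚ.toℕ-inject₁ j)) (ℕₚ.n≤1+n _)))))
      (subst₂ (Walk P) (es j) (et j) (walk-edge (edge j)
        (subst P (sym (es j)) (p (inject₁ j) i≤j″ (ℕₚ.≤-trans (ℕₚ.≤-reflexive (Finₚ.toℕ-inject₁ j)) (ℕₚ.n≤1+n _))))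
        (subst P (sym (et j)) (p (suc j) i≤j ℕₚ.≤-refl))))
      where
      i≤j″ : i Fin.≤ inject₁ j
      i≤j″ = ℕₚ.≤-trans i≤j' (ℕₚ.≤-reflexive (sym (Finₚ.toℕ-inject₁ j)))

  -- The two alternatives on `m` say that it lies between the minimum and the maximum of `i` and
  -- `j`, so the order of `i` and `j` need not be known.
  walk-connected : ∀ {P n} (vtx : Fin (suc n) → V G) (edge : Fin n → E G) →
    (∀ i → src G (edge i) ≡ vtx (inject₁ i)) → (∀ i → tgt G (edge i) ≡ vtx (suc i)) →
    ∀ i j → (∀ m → i Fin.≤ m ⊎ j Fin.≤ m → m Fin.≤ i ⊎ m Fin.≤ j → P (vtx m)) → Walk P (vtx i) (vtx j)
  walk-connected vtx edge es et i j p with ℕₚ.≤-total (toℕ i) (toℕ j)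
  ... | inj₁ i≤j = walk-line vtx edge es et i j i≤j (λ m i≤m m≤j → p m (inj₁ i≤m) (inj₂ m≤j))
  ... | inj₂ j≤i = walk-sym (walk-line vtx edge es et j i j≤i (λ m j≤m m≤i → p m (inj₂ j≤m) (inj₁ m≤i)))

  -- The walk from `x i` to `y j` stays in the branch sets of `i` and `j`. For distinct indices on
  -- both sides the two walks have no vertex in common, so their edges are pairwise independent and
  -- the linking vanishes.
  K₃₃-minor-free : (branch : V G → Fin 3 ⊎ Fin 3) (x y : Fin 3 → V G) → (∀ j → branch (y j) ≡ inj₂ j) →
    ¬ (∀ i j → Walk (λ v → branch v ≡ inj₁ i ⊎ branch v ≡ inj₂ j) (x i) (y j))
  K₃₃-minor-free branch x y by W = K₃₃-linked (λ i → pos (x i)) (λ j → pos (y j)) (λ i j → over′ (W i j))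
    (λ i j i≢j e → i≢j (inj₂-inj (trans (sym (by i)) (trans (cong branch (pos-inj _ _ e)) (by j)))))
    (λ i i' j j' i≢i' j≢j' → linking-chains (unlinked i≢i' j≢j') (chain (W i j)) (chain (W i' j')))
    where
    inj₂-inj : ∀ {i j : Fin 3} → inj₂ {A = Fin 3} i ≡ inj₂ j → i ≡ j
    inj₂-inj refl = refl
    In : Fin 3 → Fin 3 → V G → Set
    In i j v = branch v ≡ inj₁ i ⊎ branch v ≡ inj₂ j
    apart : ∀ {i i' j j'} → i ≢ i' → j ≢ j' → ∀ v → In i j v → In i' j' v → ⊥
    apart i≢i' j≢j' v (inj₁ e) (inj₁ e') with trans (sym e) e'
    ... | refl = i≢i' refl
    apart i≢i' j≢j' v (inj₁ e) (inj₂ e') with trans (sym e) e'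
    ... | ()
    apart i≢i' j≢j' v (inj₂ e) (inj₁ e') with trans (sym e) e'
    ... | ()
    apart i≢i' j≢j' v (inj₂ e) (inj₂ e') with trans (sym e) e'
    ... | refl = j≢j' refl
    end-in : ∀ {P e v} → P (src G e) → P (tgt G e) → End e v → P v
    end-in p q (inj₁ refl) = p
    end-in p q (inj₂ refl) = q
    unlinked : ∀ {i i' j j'} → i ≢ i' → j ≢ j' → ∀ {X Y} → EdgeIn (In i j) X → EdgeIn (In i' j') Y → linking X Y ≡ false
    unlinked {i} {i'} {j} {j'} i≢i' j≢j' (e , p , q , refl) (f , p' , q' , refl) = independent-unlinked e f
      (λ v ve vf → apart i≢i' j≢j' v (end-in {In i j} p q ve) (end-in {In i' j'} p' q' vf))

-- Tents over the x-axis

ι : ℕ → ℚ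
ι zero    = 0ℚ
ι (suc n) = 1ℚ + ι n

0<1 : 0ℚ < 1ℚ
0<1 = ℚₚ.positive⁻¹ 1ℚ

0≤ι : ∀ n → 0ℚ ≤ ι n
0≤ι zero    = ℚₚ.≤-refl
0≤ι (suc n) = 0≤p+q (ℚₚ.<⇒≤ 0<1) (0≤ι n)

0<ι : ∀ n → 0ℚ < ι (suc n)
0<ι n = 0<p+q 0<1 (0≤ι n)

ι-mono-≤ : ∀ {m n} → m ℕ.≤ n → ι m ≤ ι n
ι-mono-≤ {n = n} ℕ.z≤n = 0≤ι n
ι-mono-≤ (ℕ.s≤s h)     = ℚₚ.+-monoʳ-≤ 1ℚ (ι-mono-≤ h)

ι-mono-< : ∀ {m n} → m ℕ.< n → ι m < ι n
ι-mono-< {n = suc n} (ℕ.s≤s ℕ.z≤n) = 0<ι n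
ι-mono-< (ℕ.s≤s h@(ℕ.s≤s _))       = ℚₚ.+-monoʳ-< 1ℚ (ι-mono-< h)

ι-cancel-≤ : ∀ {m n} → ι m ≤ ι n → m ℕ.≤ n
ι-cancel-≤ {m} {n} h with m ℕₚ.≤? n
... | yes m≤n = m≤n
... | no m≰n  = ⊥-elim (ℚₚ.<-irrefl refl (ℚₚ.<-≤-trans (ι-mono-< (ℕₚ.≰⇒> m≰n)) h))

ι-injective : ∀ {m n} → ι m ≡ ι n → m ≡ n
ι-injective e = ℕₚ.≤-antisym (ι-cancel-≤ (ℚₚ.≤-reflexive e)) (ι-cancel-≤ (ℚₚ.≤-reflexive (sym e)))

-- A tent has feet (l , 0), (r , 0) and apex (x₀ , h); the weights s, t are those of the foot and of the apex.
record OnTent (l x₀ h r : ℚ) (x : Point) : Set where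
  constructor onTent
  field
    s t    : ℚ
    0≤s    : 0ℚ ≤ s
    0≤t    : 0ℚ ≤ t
    s+t≡1  : s + t ≡ 1ℚ
    height : proj₂ x ≡ h * t
    offset : x₀ - proj₁ x ≡ (x₀ - l) * s ⊎ proj₁ x - x₀ ≡ (r - x₀) * s

onLeftLeg : ∀ {l x₀ h r x} → OnSeg x ((l , 0ℚ) , (x₀ , h)) → OnTent l x₀ h r x
onLeftLeg {l} {x₀} {h} (t , 0≤t , t≤1 , refl) =
  onTent (1ℚ - t) t (p≤q⇒0≤q-p t≤1) 0≤t (e₁ t) (e₂ t h) (inj₁ (e₃ t l x₀))
  where
  e₁ : ∀ t → 1ℚ - t + t ≡ 1ℚ
  e₁ = solve-∀ ℚ-ring
  e₂ : ∀ t h → 0ℚ + t * (h - 0ℚ) ≡ h * t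
  e₂ = solve-∀ ℚ-ring
  e₃ : ∀ t l x₀ → x₀ - (l + t * (x₀ - l)) ≡ (x₀ - l) * (1ℚ - t)
  e₃ = solve-∀ ℚ-ring

onRightLeg : ∀ {l x₀ h r x} → OnSeg x ((x₀ , h) , (r , 0ℚ)) → OnTent l x₀ h r x
onRightLeg {l} {x₀} {h} {r} (s , 0≤s , s≤1 , refl) =
  onTent s (1ℚ - s) 0≤s (p≤q⇒0≤q-p s≤1) (e₁ s) (e₂ s h) (inj₂ (e₃ s r x₀))
  where
  e₁ : ∀ s → s + (1ℚ - s) ≡ 1ℚ
  e₁ = solve-∀ ℚ-ring
  e₂ : ∀ s h → h + s * (0ℚ - h) ≡ h * (1ℚ - s)
  e₂ = solve-∀ ℚ-ring
  e₃ : ∀ s r x₀ → x₀ + s * (r - x₀) - x₀ ≡ (r - x₀) * s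
  e₃ = solve-∀ ℚ-ring

mirror-tent : ∀ {l x₀ h r X Y} → OnTent l x₀ (- h) r (X , Y) → OnTent l x₀ h r (X , - Y)
mirror-tent {h = h} (onTent s t 0≤s 0≤t e y≡ o) = onTent s t 0≤s 0≤t e (trans (cong -_ y≡) (i h t)) o
  where
  i : ∀ h t → - (- h * t) ≡ h * t
  i = solve-∀ ℚ-ring

p*q≡0∧0<p⇒q≡0 : ∀ {p q} → 0ℚ < p → p * q ≡ 0ℚ → q ≡ 0ℚ
p*q≡0∧0<p⇒q≡0 {p} {q} 0<p e with 0<p⇒p-invertible 0<p
... | r , _ , k = trans (sym (ℚₚ.*-identityʳ q)) (trans (cong (q *_) (sym k))
  (trans (i p q r) (trans (cong (_* r) e) (ℚₚ.*-zeroˡ r))))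
  where
  i : ∀ p q r → q * (p * r) ≡ p * q * r
  i = solve-∀ ℚ-ring

tent-y≥0 : ∀ {l x₀ h r X Y} → 0ℚ < h → OnTent l x₀ h r (X , Y) → 0ℚ ≤ Y
tent-y≥0 0<h T = subst (0ℚ ≤_) (sym height) (0≤p*q (ℚₚ.<⇒≤ 0<h) 0≤t)
  where open OnTent T

tent-foot : ∀ {l x₀ h r X Y} → 0ℚ < h → OnTent l x₀ h r (X , Y) → Y ≡ 0ℚ → X ≡ l ⊎ X ≡ r
tent-foot {l} {x₀} {h} {r} {X} 0<h (onTent s t _ _ e y≡ o) y≡0 = foot o
  where
  s≡1 : s ≡ 1ℚ
  s≡1 = trans (trans (sym (ℚₚ.+-identityʳ s)) (cong (s +_) (sym (p*q≡0∧0<p⇒q≡0 0<h (trans (sym y≡) y≡0))))) e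
  i : ∀ x₀ X → X ≡ x₀ - (x₀ - X)
  i = solve-∀ ℚ-ring
  j : ∀ x₀ l → x₀ - (x₀ - l) * 1ℚ ≡ l
  j = solve-∀ ℚ-ring
  i′ : ∀ x₀ X → X ≡ x₀ + (X - x₀)
  i′ = solve-∀ ℚ-ring
  j′ : ∀ x₀ r → x₀ + (r - x₀) * 1ℚ ≡ r
  j′ = solve-∀ ℚ-ring
  foot : x₀ - X ≡ (x₀ - l) * s ⊎ X - x₀ ≡ (r - x₀) * s → X ≡ l ⊎ X ≡ r
  foot (inj₁ oˡ) = inj₁ (trans (i x₀ X) (trans (cong (λ u → x₀ - u) (trans oˡ (cong ((x₀ - l) *_) s≡1))) (j x₀ l)))
  foot (inj₂ oʳ) = inj₂ (trans (i′ x₀ X) (trans (cong (x₀ +_) (trans oʳ (cong ((r - x₀) *_) s≡1))) (j′ x₀ r)))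

tent-≤r : ∀ {l x₀ h r X Y} → l < x₀ → x₀ < r → OnTent l x₀ h r (X , Y) → X ≤ r
tent-≤r {l} {x₀} {h} {r} {X} l<x₀ x₀<r (onTent s t 0≤s 0≤t e _ (inj₁ o)) =
  ℚₚ.≤-trans (0≤q-p⇒p≤q (subst (0ℚ ≤_) (sym o) (0≤p*q (ℚₚ.<⇒≤ (p<q⇒0<q-p l<x₀)) 0≤s))) (ℚₚ.<⇒≤ x₀<r)
tent-≤r {l} {x₀} {h} {r} {X} l<x₀ x₀<r (onTent s t 0≤s 0≤t e _ (inj₂ o)) =
  0≤q-p⇒p≤q (subst (0ℚ ≤_) (trans (i x₀ r s t) (trans (cong₂ (λ u v → (r - x₀) * u - v) e (sym o)) (j x₀ r X)))
    (0≤p*q (ℚₚ.<⇒≤ (p<q⇒0<q-p x₀<r)) 0≤t))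
  where
  i : ∀ x₀ r s t → (r - x₀) * t ≡ (r - x₀) * (s + t) - (r - x₀) * s
  i = solve-∀ ℚ-ring
  j : ∀ x₀ r X → (r - x₀) * 1ℚ - (X - x₀) ≡ r - X
  j = solve-∀ ℚ-ring

-- The tent rises only strictly between its feet. Together with `tent-≤r` this separates two tents
-- standing side by side.
tent-≤l⇒y≡0 : ∀ {l x₀ h r X Y} → l < x₀ → x₀ < r → OnTent l x₀ h r (X , Y) → X ≤ l → Y ≡ 0ℚ
tent-≤l⇒y≡0 {l} {x₀} {h} {r} {X} l<x₀ x₀<r (onTent s t 0≤s 0≤t e y≡ (inj₁ o)) X≤l =
  trans y≡ (trans (cong (h *_) t≡0) (ℚₚ.*-zeroʳ h))
  where
  i : ∀ x₀ l X → x₀ - l - (x₀ - X) ≡ - (l - X)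
  i = solve-∀ ℚ-ring
  j : ∀ x₀ l s t → (x₀ - l) * t ≡ (x₀ - l) * (s + t) - (x₀ - l) * s
  j = solve-∀ ℚ-ring
  k : (x₀ - l) * t ≡ - (l - X)
  k = trans (j x₀ l s t) (trans (cong₂ _-_ (trans (cong ((x₀ - l) *_) e) (ℚₚ.*-identityʳ (x₀ - l))) (sym o)) (i x₀ l X))
  ≤0 : (x₀ - l) * t ≤ 0ℚ
  ≤0 = subst (_≤ 0ℚ) (sym k) (ℚₚ.neg-antimono-≤ (p≤q⇒0≤q-p X≤l))
  t≡0 : t ≡ 0ℚ
  t≡0 = p*q≡0∧0<p⇒q≡0 (p<q⇒0<q-p l<x₀) (ℚₚ.≤-antisym ≤0 (0≤p*q (ℚₚ.<⇒≤ (p<q⇒0<q-p l<x₀)) 0≤t))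
tent-≤l⇒y≡0 {l} {x₀} {h} {r} {X} l<x₀ x₀<r (onTent s t 0≤s 0≤t e y≡ (inj₂ o)) X≤l =
  ⊥-elim (ℚₚ.<-irrefl refl (ℚₚ.≤-<-trans (ℚₚ.≤-trans x₀≤X X≤l) l<x₀))
  where
  x₀≤X : x₀ ≤ X
  x₀≤X = 0≤q-p⇒p≤q (subst (0ℚ ≤_) (sym o) (0≤p*q (ℚₚ.<⇒≤ (p<q⇒0<q-p x₀<r)) 0≤s))

-- At a common point with t > 0 the lower tent has the smaller foot weight s, which makes its distance from the
-- vertical through the apex too small.
tents-nested : ∀ {l l' x₀ h h' r r' X Y} → l < x₀ → x₀ < r → 0ℚ < h → l' ≤ l → h < h' → r ≤ r' →
  OnTent l x₀ h r (X , Y) → OnTent l' x₀ h' r' (X , Y) → Y ≡ 0ℚ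
tents-nested {l} {l'} {x₀} {h} {h'} {r} {r'} {X} {Y} l<x₀ x₀<r 0<h l'≤l h<h' r≤r'
  (onTent s t 0≤s 0≤t e y≡ o) (onTent s' t' 0≤s' 0≤t' e' y'≡ o') with t ℚₚ.≟ 0ℚ
... | yes refl = trans y≡ (ℚₚ.*-zeroʳ h)
... | no t≢0   = ⊥-elim (clash o o')
  where
  0<t : 0ℚ < t
  0<t = 0≤p∧p≢0⇒0<p 0≤t t≢0
  t'<t : t' < t
  t'<t = ℚₚ.≰⇒> λ t≤t' → ℚₚ.<-irrefl (trans (sym y≡) y'≡) (ℚₚ.<-≤-trans
    (0<q-p⇒p<q (subst (0ℚ <_) (i h h' t) (0<p*q (p<q⇒0<q-p h<h') 0<t)))
    (0≤q-p⇒p≤q (subst (0ℚ ≤_) (j h' t t') (0≤p*q (ℚₚ.<⇒≤ (ℚₚ.<-trans 0<h h<h')) (p≤q⇒0≤q-p t≤t')))))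
    where
    i : ∀ h h' t → (h' - h) * t ≡ h' * t - h * t
    i = solve-∀ ℚ-ring
    j : ∀ h' t t' → h' * (t' - t) ≡ h' * t' - h' * t
    j = solve-∀ ℚ-ring
  s<s' : s < s'
  s<s' = 0<q-p⇒p<q (subst (0ℚ <_)
    (trans (i s s' t t') (trans (cong₂ (λ u v → u - v + (s' - s)) e e') (j s s'))) (p<q⇒0<q-p t'<t))
    where
    i : ∀ s s' t t' → t - t' ≡ (s + t) - (s' + t') + (s' - s)
    i = solve-∀ ℚ-ring
    j : ∀ s s' → 1ℚ - 1ℚ + (s' - s) ≡ s' - s
    j = solve-∀ ℚ-ring
  grows : ∀ {a a'} → 0ℚ < a → a ≤ a' → a * s < a' * s'
  grows {a} {a'} 0<a a≤a' = ℚₚ.<-≤-trans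
    (0<q-p⇒p<q (subst (0ℚ <_) (i a s s') (0<p*q 0<a (p<q⇒0<q-p s<s'))))
    (0≤q-p⇒p≤q (subst (0ℚ ≤_) (j a a' s') (0≤p*q (p≤q⇒0≤q-p a≤a') 0≤s')))
    where
    i : ∀ a s s' → a * (s' - s) ≡ a * s' - a * s
    i = solve-∀ ℚ-ring
    j : ∀ a a' s' → (a' - a) * s' ≡ a' * s' - a * s'
    j = solve-∀ ℚ-ring
  0<s' : 0ℚ < s'
  0<s' = ℚₚ.≤-<-trans 0≤s s<s'
  l'<x₀ = ℚₚ.≤-<-trans l'≤l l<x₀
  x₀<r' = ℚₚ.<-≤-trans x₀<r r≤r'
  opposite : ∀ u v → 0ℚ ≤ u - v → 0ℚ < v - u → ⊥
  opposite u v h k = ℚₚ.<-irrefl refl (ℚₚ.<-≤-trans (0<q-p⇒p<q {u} {v} k) (0≤q-p⇒p≤q {v} {u} h))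
  left-mono : ∀ {l l'} → l' ≤ l → x₀ - l ≤ x₀ - l'
  left-mono h = ℚₚ.+-monoʳ-≤ x₀ (ℚₚ.neg-antimono-≤ h)
  clash : x₀ - X ≡ (x₀ - l) * s ⊎ X - x₀ ≡ (r - x₀) * s → x₀ - X ≡ (x₀ - l') * s' ⊎ X - x₀ ≡ (r' - x₀) * s' → ⊥
  clash (inj₁ o) (inj₁ o') = ℚₚ.<-irrefl (trans (sym o) o') (grows (p<q⇒0<q-p l<x₀) (left-mono l'≤l))
  clash (inj₂ o) (inj₂ o') = ℚₚ.<-irrefl (trans (sym o) o') (grows (p<q⇒0<q-p x₀<r) (ℚₚ.+-monoˡ-≤ (- x₀) r≤r'))
  -- On legs of opposite sides, the point would be weakly on one side of the vertical through the
  -- apex and, as `s'` is positive, strictly on the other.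
  clash (inj₁ o) (inj₂ o') = opposite x₀ X (subst (0ℚ ≤_) (sym o) (0≤p*q (ℚₚ.<⇒≤ (p<q⇒0<q-p l<x₀)) 0≤s))
    (subst (0ℚ <_) (sym o') (0<p*q (p<q⇒0<q-p x₀<r') 0<s'))
  clash (inj₂ o) (inj₁ o') = opposite X x₀ (subst (0ℚ ≤_) (sym o) (0≤p*q (ℚₚ.<⇒≤ (p<q⇒0<q-p x₀<r)) 0≤s))
    (subst (0ℚ <_) (sym o') (0<p*q (p<q⇒0<q-p l'<x₀) 0<s'))

-- The horizontal distances to the apex along the two legs are nonnegative and add up to zero.
tent-legs-meet : ∀ {l x₀ h r} → l < x₀ → x₀ < r → ∀ x →
  OnSeg x ((l , 0ℚ) , (x₀ , h)) → OnSeg x ((x₀ , h) , (r , 0ℚ)) → x ≡ (x₀ , h)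
tent-legs-meet {l} {x₀} {h} {r} l<x₀ x₀<r x (t , 0≤t , t≤1 , refl) (t' , 0≤t' , t'≤1 , e) =
  subst (λ t → lerp t (l , 0ℚ) (x₀ , h) ≡ (x₀ , h)) (sym t≡1) (cong₂ _,_ (i l x₀) (i 0ℚ h))
  where
  i : ∀ a b → a + 1ℚ * (b - a) ≡ b
  i = solve-∀ ℚ-ring
  j : ∀ l x₀ r t t' → (x₀ - l) * (1ℚ - t) + (r - x₀) * t' ≡ (x₀ + t' * (r - x₀)) - (l + t * (x₀ - l))
  j = solve-∀ ℚ-ring
  z : (x₀ - l) * (1ℚ - t) ≡ 0ℚ
  z = 0≤p∧0≤q∧p+q≡0⇒p≡0 (0≤p*q (ℚₚ.<⇒≤ (p<q⇒0<q-p l<x₀)) (p≤q⇒0≤q-p t≤1))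
    (0≤p*q (ℚₚ.<⇒≤ (p<q⇒0<q-p x₀<r)) 0≤t')
    (trans (j l x₀ r t t') (trans (cong (_- (l + t * (x₀ - l))) (sym (cong proj₁ e))) (ℚₚ.+-inverseʳ (l + t * (x₀ - l)))))
  t≡1 : t ≡ 1ℚ
  t≡1 = sym (p-q≡0⇒p≡q {1ℚ} {t} (p*q≡0∧0<p⇒q≡0 (p<q⇒0<q-p l<x₀) z))

simple-path₂ : ∀ {a m b} → a ≢ m → m ≢ b → (∀ x → OnSeg x (a , m) → OnSeg x (m , b) → x ≡ m) →
  SimplePoly (a ∷ m ∷ b ∷ [])
simple-path₂ a≢m m≢b meet = (λ { zero → a≢m ; (suc zero) → m≢b }) , λ where
  zero       (suc zero) x _ h h'            → refl , meet x h h'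
  zero       zero       x () h h'
  (suc zero) zero       x () h h'
  (suc zero) (suc zero) x (ℕ.s≤s ()) h h'

-- A common point of the two halves is the joint `s`, which by simplicity of each half lies on
-- neither outer segment. Hence only consecutive segments touch.
simple-path₄ : ∀ {a m s m' b} → SimplePoly (a ∷ m ∷ s ∷ []) → SimplePoly (s ∷ m' ∷ b ∷ []) →
  (∀ x → OnPoly x (a ∷ m ∷ s ∷ []) → OnPoly x (s ∷ m' ∷ b ∷ []) → x ≡ s) →
  SimplePoly (a ∷ m ∷ s ∷ m' ∷ b ∷ [])
simple-path₄ {a} {m} {s} {m'} {b} (nd , sm) (nd' , sm') meet = nondeg , simple
  where
  s∉am : ¬ OnSeg s (a , m)
  s∉am h = nd (suc zero) (sym (proj₂ (sm zero (suc zero) s (ℕ.s≤s ℕ.z≤n) h (onSeg-end m s))))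
  s∉m'b : ¬ OnSeg s (m' , b)
  s∉m'b h = nd' zero (proj₂ (sm' zero (suc zero) s (ℕ.s≤s ℕ.z≤n) (onSeg-start s m') h))
  nondeg : ∀ i → _
  nondeg zero                   = nd zero
  nondeg (suc zero)             = nd (suc zero)
  nondeg (suc (suc zero))       = nd' zero
  nondeg (suc (suc (suc zero))) = nd' (suc zero)
  simple : ∀ i j x → toℕ i ℕ.< toℕ j → OnSeg x (lookup (segs (a ∷ m ∷ s ∷ m' ∷ b ∷ [])) i) →
    OnSeg x (lookup (segs (a ∷ m ∷ s ∷ m' ∷ b ∷ [])) j) →
    (toℕ j ≡ suc (toℕ i)) × (x ≡ proj₂ (lookup (segs (a ∷ m ∷ s ∷ m' ∷ b ∷ [])) i))
  simple zero (suc zero) x _ h h' = sm zero (suc zero) x (ℕ.s≤s ℕ.z≤n) h h'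
  simple (suc zero) (suc (suc zero)) x _ h h' = refl , meet x (there (here h)) (here h')
  simple (suc (suc zero)) (suc (suc (suc zero))) x _ h h' = refl , proj₂ (sm' zero (suc zero) x (ℕ.s≤s ℕ.z≤n) h h')
  simple zero (suc (suc zero)) x _ h h' = ⊥-elim (s∉am (subst (λ y → OnSeg y (a , m)) (meet x (here h) (here h')) h))
  simple zero (suc (suc (suc zero))) x _ h h' =
    ⊥-elim (s∉am (subst (λ y → OnSeg y (a , m)) (meet x (here h) (there (here h'))) h))
  simple (suc zero) (suc (suc (suc zero))) x _ h h' =
    ⊥-elim (s∉m'b (subst (λ y → OnSeg y (m' , b)) (meet x (there (here h)) (there (here h'))) h'))
  simple zero zero x () _ _
  simple (suc _) zero x () _ _
  simple (suc zero) (suc zero) x (ℕ.s≤s ()) _ _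
  simple (suc (suc _)) (suc zero) x (ℕ.s≤s ()) _ _
  simple (suc (suc zero)) (suc (suc zero)) x (ℕ.s≤s (ℕ.s≤s ())) _ _
  simple (suc (suc (suc _))) (suc (suc zero)) x (ℕ.s≤s (ℕ.s≤s ())) _ _
  simple (suc (suc (suc zero))) (suc (suc (suc zero))) x (ℕ.s≤s (ℕ.s≤s (ℕ.s≤s ()))) _ _

-- The drawing of a ladder

-- A kind names a quadrant that is empty at the rung, with indices on the `u` path as columns and
-- indices on the `v` path as rows.
data Kind : Set where
  NW NE SE SW : Kind

-ι-anti-≤ : ∀ {m n} → m ℕ.≤ n → - ι n ≤ - ι m
-ι-anti-≤ h = ℚₚ.neg-antimono-≤ (ι-mono-≤ h)

-ι-anti-< : ∀ {m n} → m ℕ.< n → - ι n < - ι m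
-ι-anti-< h = ℚₚ.neg-antimono-< (ι-mono-< h)

-ι-cancel-≤ : ∀ {m n} → - ι n ≤ - ι m → m ℕ.≤ n
-ι-cancel-≤ {m} {n} h with m ℕₚ.≤? n
... | yes m≤n = m≤n
... | no m≰n  = ⊥-elim (ℚₚ.<-irrefl refl (ℚₚ.<-≤-trans (-ι-anti-< (ℕₚ.≰⇒> m≰n)) h))

-ι≤0 : ∀ n → - ι n ≤ 0ℚ
-ι≤0 n = ℚₚ.neg-antimono-≤ (0≤ι n)

-ι<0 : ∀ n → - ι (suc n) < 0ℚ
-ι<0 n = ℚₚ.neg-antimono-< (0<ι n)

-ι<ι : ∀ m n → - ι m < ι (suc n)
-ι<ι m n = ℚₚ.≤-<-trans (-ι≤0 m) (0<ι n)

-p≡0⇒p≡0 : ∀ {p} → - p ≡ 0ℚ → p ≡ 0ℚ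
-p≡0⇒p≡0 {p} e = trans (i p) (cong -_ e)
  where
  i : ∀ p → p ≡ - (- p)
  i = solve-∀ ℚ-ring

axis-segment : ∀ {a b X Y} → a ≤ b → OnSeg (X , Y) ((a , 0ℚ) , (b , 0ℚ)) → Y ≡ 0ℚ × a ≤ X × X ≤ b
axis-segment {a} {b} a≤b (t , 0≤t , t≤1 , refl) =
  e₁ t ,
  0≤q-p⇒p≤q (subst (0ℚ ≤_) (e₂ t a b) (0≤p*q 0≤t (p≤q⇒0≤q-p a≤b))) ,
  0≤q-p⇒p≤q (subst (0ℚ ≤_) (e₃ t a b) (0≤p*q (p≤q⇒0≤q-p t≤1) (p≤q⇒0≤q-p a≤b)))
  where
  e₁ : ∀ t → 0ℚ + t * (0ℚ - 0ℚ) ≡ 0ℚ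
  e₁ = solve-∀ ℚ-ring
  e₂ : ∀ t a b → t * (b - a) ≡ a + t * (b - a) - a
  e₂ = solve-∀ ℚ-ring
  e₃ : ∀ t a b → (1ℚ - t) * (b - a) ≡ b - (a + t * (b - a))
  e₃ = solve-∀ ℚ-ring

simple-path₁ : ∀ {a b} → a ≢ b → SimplePoly (a ∷ b ∷ [])
simple-path₁ a≢b = (λ { zero → a≢b }) , λ { zero zero _ () _ _ }

<⇒≢ₓ : ∀ {a b c d : ℚ} → a < b → (a , c) ≢ (b , d)
<⇒≢ₓ a<b refl = ℚₚ.<-irrefl refl a<b

>⇒≢ₓ : ∀ {a b c d : ℚ} → b < a → (a , c) ≢ (b , d)
>⇒≢ₓ b<a refl = ℚₚ.<-irrefl refl b<a

simple-tent : ∀ {l x₀ h r} → l < x₀ → x₀ < r → SimplePoly ((l , 0ℚ) ∷ (x₀ , h) ∷ (r , 0ℚ) ∷ [])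
simple-tent l<x₀ x₀<r = simple-path₂ (<⇒≢ₓ l<x₀) (<⇒≢ₓ x₀<r) (tent-legs-meet l<x₀ x₀<r)

simple-tent-reversed : ∀ {l x₀ h r} → l < x₀ → x₀ < r → SimplePoly ((r , 0ℚ) ∷ (x₀ , h) ∷ (l , 0ℚ) ∷ [])
simple-tent-reversed {l} {x₀} {h} {r} l<x₀ x₀<r = simple-path₂ (>⇒≢ₓ x₀<r) (>⇒≢ₓ l<x₀)
  λ x o o' → tent-legs-meet l<x₀ x₀<r x (onSeg-sym (x₀ , h) (l , 0ℚ) o') (onSeg-sym (r , 0ℚ) (x₀ , h) o)

absurd-< : ∀ {p q r : ℚ} → p ≡ q → p ≡ r → ¬ q < r
absurd-< refl refl = ℚₚ.<-irrefl refl

≤-<-absurd : ∀ {p q : ℚ} → p ≤ q → ¬ q < p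
≤-<-absurd p≤q q<p = ℚₚ.<-irrefl refl (ℚₚ.≤-<-trans p≤q q<p)

shared-foot : ∀ {x a b s} → proj₂ x ≡ 0ℚ → a < b → proj₁ x ≡ a ⊎ proj₁ x ≡ s → proj₁ x ≡ s ⊎ proj₁ x ≡ b →
  x ≡ (s , 0ℚ)
shared-foot y≡0 _   (inj₂ x≡) _         = cong₂ _,_ x≡ y≡0
shared-foot y≡0 _   (inj₁ _)  (inj₁ x≡) = cong₂ _,_ x≡ y≡0
shared-foot y≡0 a<b (inj₁ e)  (inj₂ e') = ⊥-elim (absurd-< e e' a<b)

-ι-injective : ∀ {m n} → - ι m ≡ - ι n → m ≡ n
-ι-injective e = ℕₚ.≤-antisym (-ι-cancel-≤ (ℚₚ.≤-reflexive (sym e))) (-ι-cancel-≤ (ℚₚ.≤-reflexive e))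

squeeze : ∀ {m n} → m ℕ.≤ n → n ℕ.≤ suc m → n ≡ m ⊎ n ≡ suc m
squeeze m≤n n≤1+m with ℕₚ.m≤n⇒m<n∨m≡n n≤1+m
... | inj₁ n<1+m = inj₁ (ℕₚ.≤-antisym (ℕ.s≤s⁻¹ n<1+m) m≤n)
... | inj₂ n≡1+m = inj₂ n≡1+m

module _ {k l : ℕ} {R : Fin (suc k) → Fin (suc l) → Bool} where

  anyRung? : ∀ {P : Rung k l R → Set} → Decidable P → Dec (∃ P)
  anyRung? {P} P? = map′ (λ { (i , j , r , p) → ((i , j) , r) , p }) (λ { (((i , j) , r) , p) → i , j , r , p })
    (Finₚ.any? λ i → Finₚ.any? λ j → at i j)
    where
    at : ∀ i j → Dec (Σ (T (R i j)) λ r → P ((i , j) , r))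
    at i j with T? (R i j)
    ... | no ¬r = no λ { (r , _) → ¬r r }
    ... | yes r = map′ (r ,_) (λ { (r' , p) → subst (λ r → P ((i , j) , r)) (T-irrelevant r' r) p }) (P? ((i , j) , r))

  col row : Rung k l R → ℕ
  col ((i , _) , _) = toℕ i
  row ((_ , j) , _) = toℕ j

  Quadrant : Kind → Rung k l R → Rung k l R → Set
  Quadrant NW e e' = col e' ℕ.< col e × row e ℕ.< row e'
  Quadrant NE e e' = col e ℕ.< col e' × row e ℕ.< row e'
  Quadrant SE e e' = col e ℕ.< col e' × row e' ℕ.< row e
  Quadrant SW e e' = col e' ℕ.< col e × row e' ℕ.< row e

  quadrant? : ∀ κ e e' → Dec (Quadrant κ e e')
  quadrant? NW e e' = (col e' ℕₚ.<? col e) ×-dec (row e ℕₚ.<? row e')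
  quadrant? NE e e' = (col e ℕₚ.<? col e') ×-dec (row e ℕₚ.<? row e')
  quadrant? SE e e' = (col e ℕₚ.<? col e') ×-dec (row e' ℕₚ.<? row e)
  quadrant? SW e e' = (col e' ℕₚ.<? col e) ×-dec (row e' ℕₚ.<? row e)

  -- The priority among several empty quadrants settles the ties between rungs in a common row or column.
  data HasKind (e : Rung k l R) : Kind → Set where
    nw : ¬ ∃ (Quadrant NW e) → HasKind e NW
    ne : ∃ (Quadrant NW e) → ¬ ∃ (Quadrant NE e) → HasKind e NE
    se : ∃ (Quadrant NW e) → ∃ (Quadrant NE e) → ¬ ∃ (Quadrant SE e) → HasKind e SE
    sw : ∃ (Quadrant NW e) → ∃ (Quadrant NE e) → ∃ (Quadrant SE e) → ¬ ∃ (Quadrant SW e) → HasKind e SW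

  emptyQuadrant? : ∀ e →
    (∃ (Quadrant NW e) × ∃ (Quadrant NE e) × ∃ (Quadrant SE e) × ∃ (Quadrant SW e)) ⊎ ∃ (HasKind e)
  emptyQuadrant? e with anyRung? (quadrant? NW e)
  ... | no ¬nw = inj₂ (_ , nw ¬nw)
  ... | yes qnw with anyRung? (quadrant? NE e)
  ...   | no ¬ne = inj₂ (_ , ne qnw ¬ne)
  ...   | yes qne with anyRung? (quadrant? SE e)
  ...     | no ¬se = inj₂ (_ , se qnw qne ¬se)
  ...     | yes qse with anyRung? (quadrant? SW e)
  ...       | no ¬sw = inj₂ (_ , sw qnw qne qse ¬sw)
  ...       | yes qsw = inj₁ (qnw , qne , qse , qsw)

  -- The chains formed by the rungs of each kind

  record Increasing (e e' : Rung k l R) : Set where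
    constructor _,_
    field
      col≤ : col e ℕ.≤ col e'
      row≤ : row e ℕ.≤ row e'

  record Decreasing (e e' : Rung k l R) : Set where
    constructor _,_
    field
      col≤ : col e ℕ.≤ col e'
      row≥ : row e' ℕ.≤ row e

  record Distinct (e e' : Rung k l R) : Set where
    constructor distinct
    field
      apart : ¬ (col e ≡ col e' × row e ≡ row e')

  distinct-sym : ∀ {e e'} → Distinct e e' → Distinct e' e
  distinct-sym (distinct d) = distinct λ (c , r) → d (sym c , sym r)

  -- Of two rungs not ordered this way, one lies to the upper left of the other, in a quadrant that
  -- is empty. The next three lemmas argue alike.
  nw-increasing : ∀ {e e'} → HasKind e NW → HasKind e' NW → Increasing e e' ⊎ Increasing e' e
  nw-increasing {e} {e'} (nw ¬q) (nw ¬q') with ℕₚ.<-cmp (col e) (col e')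
  ... | tri< i<i' _ _ = inj₁ (ℕₚ.<⇒≤ i<i' , ℕₚ.≮⇒≥ λ j'<j → ¬q' (e , i<i' , j'<j))
  ... | tri> _ _ i'<i = inj₂ (ℕₚ.<⇒≤ i'<i , ℕₚ.≮⇒≥ λ j<j' → ¬q (e' , i'<i , j<j'))
  ... | tri≈ _ i≡i' _ with ℕₚ.≤-total (row e) (row e')
  ...   | inj₁ j≤j' = inj₁ (ℕₚ.≤-reflexive i≡i' , j≤j')
  ...   | inj₂ j'≤j = inj₂ (ℕₚ.≤-reflexive (sym i≡i') , j'≤j)

  se-increasing : ∀ {e e'} → HasKind e SE → HasKind e' SE → Increasing e e' ⊎ Increasing e' e
  se-increasing {e} {e'} (se _ _ ¬q) (se _ _ ¬q') with ℕₚ.<-cmp (col e) (col e')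
  ... | tri< i<i' _ _ = inj₁ (ℕₚ.<⇒≤ i<i' , ℕₚ.≮⇒≥ λ j'<j → ¬q (e' , i<i' , j'<j))
  ... | tri> _ _ i'<i = inj₂ (ℕₚ.<⇒≤ i'<i , ℕₚ.≮⇒≥ λ j<j' → ¬q' (e , i'<i , j<j'))
  ... | tri≈ _ i≡i' _ with ℕₚ.≤-total (row e) (row e')
  ...   | inj₁ j≤j' = inj₁ (ℕₚ.≤-reflexive i≡i' , j≤j')
  ...   | inj₂ j'≤j = inj₂ (ℕₚ.≤-reflexive (sym i≡i') , j'≤j)

  ne-decreasing : ∀ {e e'} → HasKind e NE → HasKind e' NE → Decreasing e e' ⊎ Decreasing e' e
  ne-decreasing {e} {e'} (ne _ ¬q) (ne _ ¬q') with ℕₚ.<-cmp (col e) (col e')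
  ... | tri< i<i' _ _ = inj₁ (ℕₚ.<⇒≤ i<i' , ℕₚ.≮⇒≥ λ j<j' → ¬q (e' , i<i' , j<j'))
  ... | tri> _ _ i'<i = inj₂ (ℕₚ.<⇒≤ i'<i , ℕₚ.≮⇒≥ λ j'<j → ¬q' (e , i'<i , j'<j))
  ... | tri≈ _ i≡i' _ with ℕₚ.≤-total (row e) (row e')
  ...   | inj₁ j≤j' = inj₂ (ℕₚ.≤-reflexive (sym i≡i') , j≤j')
  ...   | inj₂ j'≤j = inj₁ (ℕₚ.≤-reflexive i≡i' , j'≤j)

  sw-decreasing : ∀ {e e'} → HasKind e SW → HasKind e' SW → Decreasing e e' ⊎ Decreasing e' e
  sw-decreasing {e} {e'} (sw _ _ _ ¬q) (sw _ _ _ ¬q') with ℕₚ.<-cmp (col e) (col e')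
  ... | tri< i<i' _ _ = inj₁ (ℕₚ.<⇒≤ i<i' , ℕₚ.≮⇒≥ λ j<j' → ¬q' (e , i<i' , j<j'))
  ... | tri> _ _ i'<i = inj₂ (ℕₚ.<⇒≤ i'<i , ℕₚ.≮⇒≥ λ j'<j → ¬q (e' , i'<i , j'<j))
  ... | tri≈ _ i≡i' _ with ℕₚ.≤-total (row e) (row e')
  ...   | inj₁ j≤j' = inj₂ (ℕₚ.≤-reflexive (sym i≡i') , j≤j')
  ...   | inj₂ j'≤j = inj₁ (ℕₚ.≤-reflexive i≡i' , j'≤j)

  -- Otherwise one rung lies in the empty quadrant of the other, unless they share a column. In that
  -- case the rung that priority places to the upper left of `e` is also to the upper left of `e'`.
  -- The next three lemmas treat the other pairs of neighbouring kinds in the same way.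
  sw-nw : ∀ {e e'} → HasKind e SW → HasKind e' NW → row e ℕ.≤ row e'
  sw-nw {e} {e'} (sw (f , fi , fj) _ _ ¬q) (nw ¬q') = ℕₚ.≮⇒≥ clash
    where
    clash : ¬ row e' ℕ.< row e
    clash j'<j with ℕₚ.<-cmp (col e) (col e')
    ... | tri< i<i' _ _ = ¬q' (e , i<i' , j'<j)
    ... | tri> _ _ i'<i = ¬q (e' , i'<i , j'<j)
    ... | tri≈ _ i≡i' _ = ¬q' (f , subst (col f ℕ.<_) i≡i' fi , ℕₚ.<-trans j'<j fj)

  nw-ne : ∀ {e e'} → HasKind e NW → HasKind e' NE → col e ℕ.≤ col e'
  nw-ne {e} {e'} (nw ¬q) (ne (f , fi , fj) ¬q') = ℕₚ.≮⇒≥ clash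
    where
    clash : ¬ col e' ℕ.< col e
    clash i'<i with ℕₚ.<-cmp (row e) (row e')
    ... | tri< j<j' _ _ = ¬q (e' , i'<i , j<j')
    ... | tri> _ _ j'<j = ¬q' (e , i'<i , j'<j)
    ... | tri≈ _ j≡j' _ = ¬q (f , ℕₚ.<-trans fi i'<i , subst (ℕ._< row f) (sym j≡j') fj)

  se-ne : ∀ {e e'} → HasKind e SE → HasKind e' NE → row e ℕ.≤ row e'
  se-ne {e} {e'} (se _ (f , fi , fj) ¬q) (ne _ ¬q') = ℕₚ.≮⇒≥ clash
    where
    clash : ¬ row e' ℕ.< row e
    clash j'<j with ℕₚ.<-cmp (col e) (col e')
    ... | tri< i<i' _ _ = ¬q (e' , i<i' , j'<j)
    ... | tri> _ _ i'<i = ¬q' (e , i'<i , j'<j)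
    ... | tri≈ _ i≡i' _ = ¬q' (f , subst (ℕ._< col f) i≡i' fi , ℕₚ.<-trans j'<j fj)

  sw-se : ∀ {e e'} → HasKind e SW → HasKind e' SE → col e ℕ.≤ col e'
  sw-se {e} {e'} (sw _ _ (f , fi , fj) ¬q) (se _ _ ¬q') = ℕₚ.≮⇒≥ clash
    where
    clash : ¬ col e' ℕ.< col e
    clash i'<i with ℕₚ.<-cmp (row e) (row e')
    ... | tri< j<j' _ _ = ¬q' (e , i'<i , j<j')
    ... | tri> _ _ j'<j = ¬q (e' , i'<i , j'<j)
    ... | tri≈ _ j≡j' _ = ¬q' (f , ℕₚ.<-trans i'<i fi , subst (row f ℕ.<_) j≡j' fj)

  -- Branch sets of the K₃,₃ minor around the rung u_a v_b: {u_a}, v above b, v below b against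
  -- {v_b}, u above a, u below a.
  branch : Fin (suc k) → Fin (suc l) → Fin (suc k) ⊎ Fin (suc l) → Fin 3 ⊎ Fin 3
  branch a b (inj₁ u) with Finₚ.<-cmp u a
  ... | tri< _ _ _ = inj₂ 2F
  ... | tri≈ _ _ _ = inj₁ 0F
  ... | tri> _ _ _ = inj₂ 1F
  branch a b (inj₂ v) with Finₚ.<-cmp v b
  ... | tri< _ _ _ = inj₁ 2F
  ... | tri≈ _ _ _ = inj₂ 0F
  ... | tri> _ _ _ = inj₁ 1F

  branch-u< : ∀ a b {u} → u Fin.< a → branch a b (inj₁ u) ≡ inj₂ 2F
  branch-u< a b {u} h with Finₚ.<-cmp u a
  ... | tri< _ _ _ = refl
  ... | tri≈ ¬h _ _ = ⊥-elim (¬h h)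
  ... | tri> ¬h _ _ = ⊥-elim (¬h h)

  branch-u≡ : ∀ a b → branch a b (inj₁ a) ≡ inj₁ 0F
  branch-u≡ a b with Finₚ.<-cmp a a
  ... | tri< _ ¬h _ = ⊥-elim (¬h refl)
  ... | tri≈ _ _ _ = refl
  ... | tri> _ ¬h _ = ⊥-elim (¬h refl)

  branch-u> : ∀ a b {u} → a Fin.< u → branch a b (inj₁ u) ≡ inj₂ 1F
  branch-u> a b {u} h with Finₚ.<-cmp u a
  ... | tri< _ _ ¬h = ⊥-elim (¬h h)
  ... | tri≈ _ _ ¬h = ⊥-elim (¬h h)
  ... | tri> _ _ _ = refl

  branch-v< : ∀ a b {v} → v Fin.< b → branch a b (inj₂ v) ≡ inj₁ 2F
  branch-v< a b {v} h with Finₚ.<-cmp v b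
  ... | tri< _ _ _ = refl
  ... | tri≈ ¬h _ _ = ⊥-elim (¬h h)
  ... | tri> ¬h _ _ = ⊥-elim (¬h h)

  branch-v≡ : ∀ a b → branch a b (inj₂ b) ≡ inj₂ 0F
  branch-v≡ a b with Finₚ.<-cmp b b
  ... | tri< _ ¬h _ = ⊥-elim (¬h refl)
  ... | tri≈ _ _ _ = refl
  ... | tri> _ ¬h _ = ⊥-elim (¬h refl)

  branch-v> : ∀ a b {v} → b Fin.< v → branch a b (inj₂ v) ≡ inj₁ 1F
  branch-v> a b {v} h with Finₚ.<-cmp v b
  ... | tri< _ _ ¬h = ⊥-elim (¬h h)
  ... | tri≈ _ _ ¬h = ⊥-elim (¬h h)
  ... | tri> _ _ _ = refl

  -- Of the nine adjacencies of the minor, the rung `e` gives one, the paths through `a` and `b`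
  -- give four, and the rungs in the four quadrants give those between the outer parts of the two
  -- paths.
  planar⇒¬crossed : Drawing (Ladder k l R) → ∀ e →
    ∃ (Quadrant SE e) → ∃ (Quadrant NE e) → ∃ (Quadrant NW e) → ∃ (Quadrant SW e) → ⊥
  planar⇒¬crossed D ((a , b) , ab)
    (((i₁ , j₁) , e₁) , i₁> , j₁<) (((i₂ , j₂) , e₂) , i₂> , j₂>)
    (((i₃ , j₃) , e₃) , i₃< , j₃>) (((i₄ , j₄) , e₄) , i₄< , j₄<) =
    K₃₃-minor-free D (branch a b) x y y-branch W
    where
    x y : Fin 3 → Fin (suc k) ⊎ Fin (suc l)
    x 0F = inj₁ a
    x 1F = inj₂ j₂
    x 2F = inj₂ j₁
    y 0F = inj₂ b
    y 1F = inj₁ i₁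
    y 2F = inj₁ i₃
    y-branch : ∀ j → branch a b (y j) ≡ inj₂ j
    y-branch 0F = branch-v≡ a b
    y-branch 1F = branch-u> a b i₁>
    y-branch 2F = branch-u< a b i₃<

    In : Fin 3 → Fin 3 → Fin (suc k) ⊎ Fin (suc l) → Set
    In i j v = branch a b v ≡ inj₁ i ⊎ branch a b v ≡ inj₂ j

    rungWalk : ∀ {P} i j r → P (inj₁ i) → P (inj₂ j) → Walk D P (inj₁ i) (inj₂ j)
    rungWalk i j r = walk-edge D (rung i j r)

    uWalk : ∀ {P} i j → (∀ m → i Fin.≤ m ⊎ j Fin.≤ m → m Fin.≤ i ⊎ m Fin.≤ j → P (inj₁ m)) →
      Walk D P (inj₁ i) (inj₁ j)
    uWalk = walk-connected D inj₁ uEdge (λ _ → refl) (λ _ → refl)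
    vWalk : ∀ {P} i j → (∀ m → i Fin.≤ m ⊎ j Fin.≤ m → m Fin.≤ i ⊎ m Fin.≤ j → P (inj₂ m)) →
      Walk D P (inj₂ i) (inj₂ j)
    vWalk = walk-connected D inj₂ vEdge (λ _ → refl) (λ _ → refl)

    beyond : ∀ {n} {c i j m : Fin n} → c Fin.< i → c Fin.< j → i Fin.≤ m ⊎ j Fin.≤ m → c Fin.< m
    beyond c<i c<j = [ ℕₚ.<-≤-trans c<i , ℕₚ.<-≤-trans c<j ]′
    before : ∀ {n} {c i j m : Fin n} → i Fin.< c → j Fin.< c → m Fin.≤ i ⊎ m Fin.≤ j → m Fin.< c
    before i<c j<c = [ (λ m≤i → ℕₚ.≤-<-trans m≤i i<c) , (λ m≤j → ℕₚ.≤-<-trans m≤j j<c) ]′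

    from-a : ∀ m → a Fin.≤ m → In 0F 1F (inj₁ m)
    from-a m h with ℕₚ.m≤n⇒m<n∨m≡n h
    ... | inj₁ a<m = inj₂ (branch-u> a b a<m)
    ... | inj₂ e with Finₚ.toℕ-injective e
    ...   | refl = inj₁ (branch-u≡ a b)
    to-a : ∀ m → m Fin.≤ a → In 0F 2F (inj₁ m)
    to-a m h with ℕₚ.m≤n⇒m<n∨m≡n h
    ... | inj₁ m<a = inj₂ (branch-u< a b m<a)
    ... | inj₂ e with Finₚ.toℕ-injective e
    ...   | refl = inj₁ (branch-u≡ a b)
    from-b : ∀ m → b Fin.≤ m → In 1F 0F (inj₂ m)
    from-b m h with ℕₚ.m≤n⇒m<n∨m≡n h
    ... | inj₁ b<m = inj₁ (branch-v> a b b<m)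
    ... | inj₂ e with Finₚ.toℕ-injective e
    ...   | refl = inj₂ (branch-v≡ a b)
    to-b : ∀ m → m Fin.≤ b → In 2F 0F (inj₂ m)
    to-b m h with ℕₚ.m≤n⇒m<n∨m≡n h
    ... | inj₁ m<b = inj₁ (branch-v< a b m<b)
    ... | inj₂ e with Finₚ.toℕ-injective e
    ...   | refl = inj₂ (branch-v≡ a b)

    W : ∀ i j → Walk D (In i j) (x i) (y j)
    W 0F 0F = rungWalk a b ab (inj₁ (branch-u≡ a b)) (inj₂ (branch-v≡ a b))
    W 0F 1F = uWalk a i₁ λ m h _ → from-a m ([ (λ a≤m → a≤m) , ℕₚ.≤-trans (ℕₚ.<⇒≤ i₁>) ]′ h)
    W 0F 2F = uWalk a i₃ λ m _ h → to-a m ([ (λ m≤a → m≤a) , (λ m≤i₃ → ℕₚ.≤-trans m≤i₃ (ℕₚ.<⇒≤ i₃<)) ]′ h)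
    W 1F 0F = vWalk j₂ b λ m h _ → from-b m ([ ℕₚ.≤-trans (ℕₚ.<⇒≤ j₂>) , (λ b≤m → b≤m) ]′ h)
    W 1F 1F = walk-trans D (walk-sym D (rungWalk i₂ j₂ e₂ (inj₂ (branch-u> a b i₂>)) (inj₁ (branch-v> a b j₂>))))
      (uWalk i₂ i₁ λ m h _ → inj₂ (branch-u> a b (beyond i₂> i₁> h)))
    W 1F 2F = walk-trans D (vWalk j₂ j₃ λ m h _ → inj₁ (branch-v> a b (beyond j₂> j₃> h)))
      (walk-sym D (rungWalk i₃ j₃ e₃ (inj₂ (branch-u< a b i₃<)) (inj₁ (branch-v> a b j₃>))))
    W 2F 0F = vWalk j₁ b λ m _ h → to-b m ([ (λ m≤j₁ → ℕₚ.≤-trans m≤j₁ (ℕₚ.<⇒≤ j₁<)) , (λ m≤b → m≤b) ]′ h)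
    W 2F 1F = walk-sym D (rungWalk i₁ j₁ e₁ (inj₂ (branch-u> a b i₁>)) (inj₁ (branch-v< a b j₁<)))
    W 2F 2F = walk-trans D (vWalk j₁ j₄ λ m _ h → inj₁ (branch-v< a b (before j₁< j₄< h)))
      (walk-trans D (walk-sym D (rungWalk i₄ j₄ e₄ (inj₂ (branch-u< a b i₄<)) (inj₁ (branch-v< a b j₄<))))
        (uWalk i₄ i₃ λ m _ h → inj₂ (branch-u< a b (before i₄< i₃< h))))

  -- Coordinates, crossing slots and tent heights

  private
    -- A strict bound for `skew`, `coskew` and `diag`. It is the width of one band of slots or
    -- heights.
    N : ℕ
    N = suc (k ℕ.+ l)

  -- Ranks along the chains: `diag` grows strictly along increasing ones, while `skew` grows and
  -- `coskew` falls strictly along decreasing ones. The subtractions are never truncated.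
  skew coskew diag : Rung k l R → ℕ
  skew e   = col e ℕ.+ (l ℕ.∸ row e)
  coskew e = row e ℕ.+ (k ℕ.∸ col e)
  diag e   = col e ℕ.+ row e

  col≤k : ∀ (e : Rung k l R) → col e ℕ.≤ k
  col≤k ((i , _) , _) = Finₚ.toℕ≤pred[n] i

  row≤l : ∀ (e : Rung k l R) → row e ℕ.≤ l
  row≤l ((_ , j) , _) = Finₚ.toℕ≤pred[n] j

  skew<N : ∀ e → skew e ℕ.< N
  skew<N e = ℕ.s≤s (ℕₚ.+-mono-≤ (col≤k e) (ℕₚ.m∸n≤m l (row e)))

  coskew<N : ∀ e → coskew e ℕ.< N
  coskew<N e = ℕ.s≤s (ℕₚ.≤-trans (ℕₚ.+-mono-≤ (row≤l e) (ℕₚ.m∸n≤m k (col e))) (ℕₚ.≤-reflexive (ℕₚ.+-comm l k)))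

  diag<N : ∀ e → diag e ℕ.< N
  diag<N e = ℕ.s≤s (ℕₚ.+-mono-≤ (col≤k e) (row≤l e))

  increasing⇒diag< : ∀ {e e'} → Distinct e e' → Increasing e e' → diag e ℕ.< diag e'
  increasing⇒diag< (distinct d) (c , r) with ℕₚ.m≤n⇒m<n∨m≡n c | ℕₚ.m≤n⇒m<n∨m≡n r
  ... | inj₁ c< | _       = ℕₚ.+-mono-<-≤ c< r
  ... | inj₂ _  | inj₁ r< = ℕₚ.+-mono-≤-< c r<
  ... | inj₂ c≡ | inj₂ r≡ = ⊥-elim (d (c≡ , r≡))

  decreasing⇒skew< : ∀ {e e'} → Distinct e e' → Decreasing e e' → skew e ℕ.< skew e'
  decreasing⇒skew< {e} (distinct d) (c , r) with ℕₚ.m≤n⇒m<n∨m≡n c | ℕₚ.m≤n⇒m<n∨m≡n r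
  ... | inj₁ c< | _       = ℕₚ.+-mono-<-≤ c< (ℕₚ.∸-monoʳ-≤ l r)
  ... | inj₂ _  | inj₁ r< = ℕₚ.+-mono-≤-< c (ℕₚ.∸-monoʳ-< r< (row≤l e))
  ... | inj₂ c≡ | inj₂ r≡ = ⊥-elim (d (c≡ , sym r≡))

  decreasing⇒coskew> : ∀ {e e'} → Distinct e e' → Decreasing e e' → coskew e' ℕ.< coskew e
  decreasing⇒coskew> {e} {e'} (distinct d) (c , r) with ℕₚ.m≤n⇒m<n∨m≡n c | ℕₚ.m≤n⇒m<n∨m≡n r
  ... | _       | inj₁ r< = ℕₚ.+-mono-<-≤ r< (ℕₚ.∸-monoʳ-≤ k c)
  ... | inj₁ c< | inj₂ _  = ℕₚ.+-mono-≤-< r (ℕₚ.∸-monoʳ-< c< (col≤k e'))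
  ... | inj₂ c≡ | inj₂ r≡ = ⊥-elim (d (c≡ , sym r≡))

  -- From left to right the axis carries the `u` positions up to -(N+2), a centre at -(N+1), the SW
  -- slots from -N to -1, the centre 0, the `v` positions from 1 to l+1, a centre at l+2, and the NE
  -- slots from l+3 on.
  uX vX : ℕ → ℚ
  uX i = - ι (suc (suc (N ℕ.+ i)))
  vX j = ι (suc j)

  -- Where a rung of kind SW (resp. NE) crosses the axis between its ends.
  slotSW slotNE : Rung k l R → ℚ
  slotSW e = - ι (suc (coskew e))
  slotNE e = ι (suc (suc (suc (l ℕ.+ skew e))))

  uX-anti-≤ : ∀ {i i'} → i ℕ.≤ i' → uX i' ≤ uX i
  uX-anti-≤ h = -ι-anti-≤ (ℕ.s≤s (ℕ.s≤s (ℕₚ.+-monoʳ-≤ N h)))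

  uX-cancel-≤ : ∀ {i i'} → uX i' ≤ uX i → i ℕ.≤ i'
  uX-cancel-≤ {i} {i'} h = ℕₚ.+-cancelˡ-≤ N i i' (ℕ.s≤s⁻¹ (ℕ.s≤s⁻¹ (-ι-cancel-≤ h)))

  uX-injective : ∀ {i i'} → uX i ≡ uX i' → i ≡ i'
  uX-injective e = ℕₚ.≤-antisym (uX-cancel-≤ (ℚₚ.≤-reflexive (sym e))) (uX-cancel-≤ (ℚₚ.≤-reflexive e))

  vX-cancel-≤ : ∀ {j j'} → vX j ≤ vX j' → j ℕ.≤ j'
  vX-cancel-≤ h = ℕ.s≤s⁻¹ (ι-cancel-≤ h)

  vX-injective : ∀ {j j'} → vX j ≡ vX j' → j ≡ j'
  vX-injective e = ℕₚ.suc-injective (ι-injective e)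

  uX<vX : ∀ i j → uX i < vX j
  uX<vX i j = -ι<ι (suc (suc (N ℕ.+ i))) j

  uX<slotSW : ∀ i e → uX i < slotSW e
  uX<slotSW i e = -ι-anti-< (ℕ.s≤s (ℕₚ.m≤n⇒m≤1+n (ℕₚ.≤-trans (coskew<N e) (ℕₚ.m≤m+n N i))))

  slotSW<vX : ∀ e j → slotSW e < vX j
  slotSW<vX e j = -ι<ι (suc (coskew e)) j

  vX<slotNE : ∀ j e → j ℕ.≤ l → vX j < slotNE e
  vX<slotNE j e j≤l = ι-mono-< (ℕ.s≤s (ℕ.s≤s (ℕₚ.m≤n⇒m≤1+n (ℕₚ.≤-trans j≤l (ℕₚ.m≤m+n l (skew e))))))

  uX<slotNE : ∀ i e → uX i < slotNE e
  uX<slotNE i e = -ι<ι (suc (suc (N ℕ.+ i))) (suc (suc (l ℕ.+ skew e)))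

  slotSW<slotNE : ∀ e e' → slotSW e < slotNE e'
  slotSW<slotNE e e' = -ι<ι (suc (coskew e)) (suc (suc (l ℕ.+ skew e')))

  -- Tents are drawn above the axis around 0, below it around a point between the u's and the slots left of 0, and
  -- below it around a point between the v's and the slots on the right.
  data Region : Set where
    upper lowerˡ lowerʳ : Region

  data Part : Kind → Set where
    nw-upper : Part NW
    se-lower : Part SE
    sw-lower sw-upper : Part SW
    ne-upper ne-lower : Part NE

  region : ∀ {κ} → Part κ → Region
  region nw-upper = upper
  region se-lower = lowerˡ
  region sw-lower = lowerˡ
  region sw-upper = upper
  region ne-upper = upper
  region ne-lower = lowerʳ

  centre : Region → ℚ
  centre upper  = 0ℚ
  centre lowerˡ = - ι (suc N)
  centre lowerʳ = ι (suc (suc l))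

  left right : ∀ {κ} → Part κ → Rung k l R → ℚ
  left nw-upper e = uX (col e)
  left se-lower e = uX (col e)
  left sw-lower e = uX (col e)
  left sw-upper e = slotSW e
  left ne-upper e = uX (col e)
  left ne-lower e = vX (row e)
  right nw-upper e = vX (row e)
  right se-lower e = vX (row e)
  right sw-lower e = slotSW e
  right sw-upper e = vX (row e)
  right ne-upper e = slotNE e
  right ne-lower e = slotNE e

  -- Above the axis the bands from the inside out are SW, NW, NE. In the left lower region they are
  -- SW, then SE. Inside a band the rank along the chain decides.
  level : ∀ {κ} → Part κ → Rung k l R → ℕ
  level nw-upper e = N ℕ.+ diag e
  level se-lower e = N ℕ.+ diag e
  level sw-lower e = skew e
  level sw-upper e = coskew e
  level ne-upper e = N ℕ.+ (N ℕ.+ skew e)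
  level ne-lower e = skew e

  apexHeight : ∀ {κ} → Part κ → Rung k l R → ℚ
  apexHeight π e = ι (suc (level π e))

  uX<lowerˡ : ∀ i → uX i < - ι (suc N)
  uX<lowerˡ i = -ι-anti-< (ℕ.s≤s (ℕ.s≤s (ℕₚ.m≤m+n N i)))

  left<centre : ∀ {κ} (π : Part κ) e → left π e < centre (region π)
  left<centre nw-upper e = -ι<0 (suc (N ℕ.+ col e))
  left<centre se-lower e = uX<lowerˡ (col e)
  left<centre sw-lower e = uX<lowerˡ (col e)
  left<centre sw-upper e = -ι<0 (coskew e)
  left<centre ne-upper e = -ι<0 (suc (N ℕ.+ col e))
  left<centre ne-lower e = ι-mono-< (ℕ.s≤s (ℕ.s≤s (row≤l e)))

  centre<right : ∀ {κ} (π : Part κ) e → centre (region π) < right π e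
  centre<right nw-upper e = 0<ι (row e)
  centre<right se-lower e = -ι<ι (suc N) (row e)
  centre<right sw-lower e = -ι-anti-< (ℕ.s≤s (coskew<N e))
  centre<right sw-upper e = 0<ι (row e)
  centre<right ne-upper e = 0<ι (suc (suc (l ℕ.+ skew e)))
  centre<right ne-lower e = ι-mono-< (ℕ.s≤s (ℕ.s≤s (ℕ.s≤s (ℕₚ.m≤m+n l (skew e)))))

  -- Reflects the lower regions, so that the statements on upward tents apply to all parts.
  upright : Region → Point → Point
  upright upper  p       = p
  upright lowerˡ (X , Y) = X , - Y
  upright lowerʳ (X , Y) = X , - Y

  record OnPart {κ} (π : Part κ) (e : Rung k l R) (x : Point) : Set where
    constructor onPart
    field
      tent : OnTent (left π e) (centre (region π)) (apexHeight π e) (right π e) (upright (region π) x)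

  record Nested {κ κ'} (π : Part κ) (e : Rung k l R) (π' : Part κ') (e' : Rung k l R) : Set where
    constructor nested
    field
      left≥  : left π' e' ≤ left π e
      level< : level π e ℕ.< level π' e'
      right≤ : right π e ≤ right π' e'

  -- The nesting is the reverse of the one below the axis: further along the chain the slot moves
  -- right, towards 0, and the `v` end moves left.
  sw-upper-nested : ∀ {e e'} → Distinct e e' → Decreasing e e' → Nested sw-upper e' sw-upper e
  sw-upper-nested d h = nested (-ι-anti-≤ (ℕ.s≤s (ℕₚ.<⇒≤ (decreasing⇒coskew> d h)))) (decreasing⇒coskew> d h)
    (ι-mono-≤ (ℕ.s≤s (Decreasing.row≥ h)))

  nw-upper-nested : ∀ {e e'} → Distinct e e' → Increasing e e' → Nested nw-upper e nw-upper e'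
  nw-upper-nested d h = nested (uX-anti-≤ (Increasing.col≤ h)) (ℕₚ.+-monoʳ-< N (increasing⇒diag< d h))
    (ι-mono-≤ (ℕ.s≤s (Increasing.row≤ h)))

  slotNE-mono : ∀ e e' → skew e ℕ.≤ skew e' → slotNE e ≤ slotNE e'
  slotNE-mono e e' h = ι-mono-≤ (ℕ.s≤s (ℕ.s≤s (ℕ.s≤s (ℕₚ.+-monoʳ-≤ l h))))

  ne-upper-nested : ∀ {e e'} → Distinct e e' → Decreasing e e' → Nested ne-upper e ne-upper e'
  ne-upper-nested {e} {e'} d h = nested (uX-anti-≤ (Decreasing.col≤ h)) (ℕₚ.+-monoʳ-< N (ℕₚ.+-monoʳ-< N (decreasing⇒skew< d h)))
    (slotNE-mono e e' (ℕₚ.<⇒≤ (decreasing⇒skew< d h)))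

  sw-lower-nested : ∀ {e e'} → Distinct e e' → Decreasing e e' → Nested sw-lower e sw-lower e'
  sw-lower-nested d h = nested (uX-anti-≤ (Decreasing.col≤ h)) (decreasing⇒skew< d h)
    (-ι-anti-≤ (ℕ.s≤s (ℕₚ.<⇒≤ (decreasing⇒coskew> d h))))

  se-lower-nested : ∀ {e e'} → Distinct e e' → Increasing e e' → Nested se-lower e se-lower e'
  se-lower-nested d h = nested (uX-anti-≤ (Increasing.col≤ h)) (ℕₚ.+-monoʳ-< N (increasing⇒diag< d h))
    (ι-mono-≤ (ℕ.s≤s (Increasing.row≤ h)))

  ne-lower-nested : ∀ {e e'} → Distinct e e' → Decreasing e e' → Nested ne-lower e ne-lower e'
  ne-lower-nested {e} {e'} d h = nested (ι-mono-≤ (ℕ.s≤s (Decreasing.row≥ h))) (decreasing⇒skew< d h)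
    (slotNE-mono e e' (ℕₚ.<⇒≤ (decreasing⇒skew< d h)))

  sw-nw-nested : ∀ {e e'} → HasKind e SW → HasKind e' NW → Nested sw-upper e nw-upper e'
  sw-nw-nested {e} {e'} h h' = nested (ℚₚ.<⇒≤ (uX<slotSW (col e') e)) (ℕₚ.<-≤-trans (coskew<N e) (ℕₚ.m≤m+n N _))
    (ι-mono-≤ (ℕ.s≤s (sw-nw h h')))

  sw-ne-nested : ∀ e e' → Nested sw-upper e ne-upper e'
  sw-ne-nested e e' = nested (ℚₚ.<⇒≤ (uX<slotSW (col e') e)) (ℕₚ.<-≤-trans (coskew<N e) (ℕₚ.m≤m+n N _))
    (ℚₚ.<⇒≤ (vX<slotNE (row e) e' (row≤l e)))

  nw-ne-nested : ∀ {e e'} → HasKind e NW → HasKind e' NE → Nested nw-upper e ne-upper e'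
  nw-ne-nested {e} {e'} h h' = nested (uX-anti-≤ (nw-ne h h')) (ℕₚ.+-monoʳ-< N (ℕₚ.<-≤-trans (diag<N e) (ℕₚ.m≤m+n N _)))
    (ℚₚ.<⇒≤ (vX<slotNE (row e) e' (row≤l e)))

  sw-se-nested : ∀ {e e'} → HasKind e SW → HasKind e' SE → Nested sw-lower e se-lower e'
  sw-se-nested {e} {e'} h h' = nested (uX-anti-≤ (sw-se h h')) (ℕₚ.<-≤-trans (skew<N e) (ℕₚ.m≤m+n N _))
    (ℚₚ.<⇒≤ (slotSW<vX e (row e')))

  nested-meet : ∀ {κ κ'} (π : Part κ) (π' : Part κ') e e' → region π ≡ region π' → Nested π e π' e' →
    ∀ x → OnPart π e x → OnPart π' e' x → proj₂ (upright (region π) x) ≡ 0ℚ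
  nested-meet π π' e e' r (nested hl hh hr) x (onPart o) (onPart o') =
    tents-nested (left<centre π e) (centre<right π e) (0<ι (level π e)) hl (ι-mono-< (ℕ.s≤s hh)) hr o
      (subst (λ ρ → OnTent (left π' e') (centre ρ) (apexHeight π' e') (right π' e') (upright ρ x)) (sym r) o')

  upright-y≡0 : ∀ ρ X Y → proj₂ (upright ρ (X , Y)) ≡ 0ℚ → Y ≡ 0ℚ
  upright-y≡0 upper  X Y e = e
  upright-y≡0 lowerˡ X Y e = -p≡0⇒p≡0 e
  upright-y≡0 lowerʳ X Y e = -p≡0⇒p≡0 e

  OnAxis : Point → Set
  OnAxis x = proj₂ x ≡ 0ℚ

  meet₁ : ∀ {κ κ'} (π : Part κ) (π' : Part κ') {e e'} → region π ≡ region π' → Nested π e π' e' →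
    ∀ x → OnPart π e x → OnPart π' e' x → OnAxis x
  meet₁ π π' {e} {e'} r n x o o' = upright-y≡0 (region π) (proj₁ x) (proj₂ x) (nested-meet π π' e e' r n x o o')

  meet₂ : ∀ {κ κ'} (π : Part κ) (π' : Part κ') {e e'} → region π ≡ region π' → Nested π e π' e' ⊎ Nested π' e' π e →
    ∀ x → OnPart π e x → OnPart π' e' x → OnAxis x
  meet₂ π π' r (inj₁ n) x o o' = meet₁ π π' r n x o o'
  meet₂ π π' r (inj₂ n) x o o' = meet₁ π' π (sym r) n x o' o

  opposite-halves : ∀ {l x₀ h r l' x₀' h' r' X Y} → 0ℚ < h → 0ℚ < h' →
    OnTent l x₀ h r (X , Y) → OnTent l' x₀' h' r' (X , - Y) → Y ≡ 0ℚ
  opposite-halves 0<h 0<h' o o' = ℚₚ.≤-antisym (0≤-p⇒p≤0 (tent-y≥0 0<h' o')) (tent-y≥0 0<h o)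

  upper-lowerˡ : ∀ {κ κ'} (π : Part κ) (π' : Part κ') e e' → region π ≡ upper → region π' ≡ lowerˡ →
    ∀ x → OnPart π e x → OnPart π' e' x → OnAxis x
  upper-lowerˡ π π' e e' r r' x (onPart o) (onPart o') with region π | region π'
  upper-lowerˡ π π' e e' refl refl x (onPart o) (onPart o') | upper | lowerˡ =
    opposite-halves (0<ι (level π e)) (0<ι (level π' e')) o o'

  upper-lowerʳ : ∀ {κ κ'} (π : Part κ) (π' : Part κ') e e' → region π ≡ upper → region π' ≡ lowerʳ →
    ∀ x → OnPart π e x → OnPart π' e' x → OnAxis x
  upper-lowerʳ π π' e e' r r' x (onPart o) (onPart o') with region π | region π'
  upper-lowerʳ π π' e e' refl refl x (onPart o) (onPart o') | upper | lowerʳ =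
    opposite-halves (0<ι (level π e)) (0<ι (level π' e')) o o'

  -- The two tents stand side by side: no point of the first is beyond its right foot, and up to
  -- there the second has not left the axis.
  lower-lower : ∀ {κ} (π : Part κ) e e' → region π ≡ lowerˡ → right π e ≤ left ne-lower e' →
    ∀ x → OnPart π e x → OnPart ne-lower e' x → OnAxis x
  lower-lower π e e' r h x (onPart o) (onPart o') = -p≡0⇒p≡0
    (tent-≤l⇒y≡0 (left<centre ne-lower e') (centre<right ne-lower e') o' (ℚₚ.≤-trans
      (tent-≤r (left<centre π e) (centre<right π e)
        (subst (λ ρ → OnTent (left π e) (centre (region π)) (apexHeight π e) (right π e) (upright ρ x)) r o)) h))

  -- Two parts in the same region are nested, parts on opposite sides of the axis are separated by
  -- it, and parts in the two lower regions stand side by side.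
  parts-meet : ∀ {κ κ'} (π : Part κ) (π' : Part κ') {e e'} → HasKind e κ → HasKind e' κ' → Distinct e e' →
    ∀ x → OnPart π e x → OnPart π' e' x → OnAxis x
  parts-meet π@nw-upper π'@nw-upper h h' d =
    meet₂ π π' refl (Sum.map (nw-upper-nested d) (nw-upper-nested (distinct-sym d)) (nw-increasing h h'))
  parts-meet π@nw-upper π'@se-lower h h' d = upper-lowerˡ π π' _ _ refl refl
  parts-meet π@nw-upper π'@sw-lower h h' d = upper-lowerˡ π π' _ _ refl refl
  parts-meet π@nw-upper π'@sw-upper h h' d = meet₂ π π' refl (inj₂ (sw-nw-nested h' h))
  parts-meet π@nw-upper π'@ne-upper h h' d = meet₂ π π' refl (inj₁ (nw-ne-nested h h'))
  parts-meet π@nw-upper π'@ne-lower h h' d = upper-lowerʳ π π' _ _ refl refl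
  parts-meet π@se-lower π'@nw-upper h h' d x o o' = upper-lowerˡ π' π _ _ refl refl x o' o
  parts-meet π@se-lower π'@se-lower h h' d =
    meet₂ π π' refl (Sum.map (se-lower-nested d) (se-lower-nested (distinct-sym d)) (se-increasing h h'))
  parts-meet π@se-lower π'@sw-lower h h' d = meet₂ π π' refl (inj₂ (sw-se-nested h' h))
  parts-meet π@se-lower π'@sw-upper h h' d x o o' = upper-lowerˡ π' π _ _ refl refl x o' o
  parts-meet π@se-lower π'@ne-upper h h' d x o o' = upper-lowerˡ π' π _ _ refl refl x o' o
  parts-meet π@se-lower π'@ne-lower h h' d = lower-lower π _ _ refl (ι-mono-≤ (ℕ.s≤s (se-ne h h')))
  parts-meet π@sw-lower π'@nw-upper h h' d x o o' = upper-lowerˡ π' π _ _ refl refl x o' o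
  parts-meet π@sw-lower π'@se-lower h h' d = meet₂ π π' refl (inj₁ (sw-se-nested h h'))
  parts-meet π@sw-lower π'@sw-lower h h' d =
    meet₂ π π' refl (Sum.map (sw-lower-nested d) (sw-lower-nested (distinct-sym d)) (sw-decreasing h h'))
  parts-meet π@sw-lower π'@sw-upper h h' d x o o' = upper-lowerˡ π' π _ _ refl refl x o' o
  parts-meet π@sw-lower π'@ne-upper h h' d x o o' = upper-lowerˡ π' π _ _ refl refl x o' o
  parts-meet π@sw-lower π'@ne-lower {e} {e'} h h' d = lower-lower π _ _ refl (ℚₚ.<⇒≤ (slotSW<vX e (row e')))
  parts-meet π@sw-upper π'@nw-upper h h' d = meet₂ π π' refl (inj₁ (sw-nw-nested h h'))
  parts-meet π@sw-upper π'@se-lower h h' d = upper-lowerˡ π π' _ _ refl refl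
  parts-meet π@sw-upper π'@sw-lower h h' d = upper-lowerˡ π π' _ _ refl refl
  parts-meet π@sw-upper π'@sw-upper h h' d =
    meet₂ π π' refl (Sum.swap (Sum.map (sw-upper-nested d) (sw-upper-nested (distinct-sym d)) (sw-decreasing h h')))
  parts-meet π@sw-upper π'@ne-upper {e} {e'} h h' d = meet₂ π π' refl (inj₁ (sw-ne-nested e e'))
  parts-meet π@sw-upper π'@ne-lower h h' d = upper-lowerʳ π π' _ _ refl refl
  parts-meet π@ne-upper π'@nw-upper h h' d = meet₂ π π' refl (inj₂ (nw-ne-nested h' h))
  parts-meet π@ne-upper π'@se-lower h h' d = upper-lowerˡ π π' _ _ refl refl
  parts-meet π@ne-upper π'@sw-lower h h' d = upper-lowerˡ π π' _ _ refl refl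
  parts-meet π@ne-upper π'@sw-upper {e} {e'} h h' d = meet₂ π π' refl (inj₂ (sw-ne-nested e' e))
  parts-meet π@ne-upper π'@ne-upper h h' d =
    meet₂ π π' refl (Sum.map (ne-upper-nested d) (ne-upper-nested (distinct-sym d)) (ne-decreasing h h'))
  parts-meet π@ne-upper π'@ne-lower h h' d = upper-lowerʳ π π' _ _ refl refl
  parts-meet π@ne-lower π'@nw-upper h h' d x o o' = upper-lowerʳ π' π _ _ refl refl x o' o
  parts-meet π@ne-lower π'@se-lower h h' d x o o' = lower-lower π' _ _ refl (ι-mono-≤ (ℕ.s≤s (se-ne h' h))) x o' o
  parts-meet π@ne-lower π'@sw-lower {e} {e'} h h' d x o o' =
    lower-lower π' _ _ refl (ℚₚ.<⇒≤ (slotSW<vX e' (row e))) x o' o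
  parts-meet π@ne-lower π'@sw-upper h h' d x o o' = upper-lowerʳ π' π _ _ refl refl x o' o
  parts-meet π@ne-lower π'@ne-upper h h' d x o o' = upper-lowerʳ π' π _ _ refl refl x o' o
  parts-meet π@ne-lower π'@ne-lower h h' d =
    meet₂ π π' refl (Sum.map (ne-lower-nested d) (ne-lower-nested (distinct-sym d)) (ne-decreasing h h'))

  -- The polygons of the rungs

  apex : ∀ {κ} → Part κ → Rung k l R → Point
  apex π e = upright (region π) (centre (region π) , apexHeight π e)

  rungBends : Kind → Rung k l R → List Point
  rungBends NW e = apex nw-upper e ∷ []
  rungBends SE e = apex se-lower e ∷ []
  rungBends SW e = apex sw-lower e ∷ (slotSW e , 0ℚ) ∷ apex sw-upper e ∷ []
  rungBends NE e = apex ne-upper e ∷ (slotNE e , 0ℚ) ∷ apex ne-lower e ∷ []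

  rungPoly : Kind → Rung k l R → List Point
  rungPoly κ e = (uX (col e) , 0ℚ) ∷ (rungBends κ e ++ [ (vX (row e) , 0ℚ) ])

  onRung : ∀ κ e x → OnPoly x (rungPoly κ e) → Σ (Part κ) λ π → OnPart π e x
  onRung NW e x (here o)         = nw-upper , onPart (onLeftLeg o)
  onRung NW e x (there (here o)) = nw-upper , onPart (onRightLeg o)
  onRung SE e x (here o)         = se-lower , onPart (mirror-tent (onLeftLeg o))
  onRung SE e x (there (here o)) = se-lower , onPart (mirror-tent (onRightLeg o))
  onRung SW e x (here o)         = sw-lower , onPart (mirror-tent (onLeftLeg o))
  onRung SW e x (there (here o)) = sw-lower , onPart (mirror-tent (onRightLeg o))
  onRung SW e x (there (there (here o)))         = sw-upper , onPart (onLeftLeg o)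
  onRung SW e x (there (there (there (here o)))) = sw-upper , onPart (onRightLeg o)
  onRung NE e x (here o)         = ne-upper , onPart (onLeftLeg o)
  onRung NE e x (there (here o)) = ne-upper , onPart (onRightLeg o)
  -- The last two segments run back from the slot to `v`, so this tent is traversed from right to
  -- left.
  onRung NE e x (there (there (here o))) =
    ne-lower , onPart (mirror-tent (onRightLeg (onSeg-sym (slotNE e , 0ℚ) (apex ne-lower e) o)))
  onRung NE e x (there (there (there (here o)))) =
    ne-lower , onPart (mirror-tent (onLeftLeg (onSeg-sym (apex ne-lower e) (vX (row e) , 0ℚ) o)))

  part-foot : ∀ {κ} (π : Part κ) {e x} → OnPart π e x → OnAxis x → proj₁ x ≡ left π e ⊎ proj₁ x ≡ right π e
  part-foot {κ} π {e} {X , Y} (onPart o) y≡0 = go (region π) o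
    where
    go : ∀ ρ → OnTent (left π e) (centre ρ) (apexHeight π e) (right π e) (upright ρ (X , Y)) → X ≡ left π e ⊎ X ≡ right π e
    go upper  o = tent-foot (0<ι (level π e)) o y≡0
    go lowerˡ o = tent-foot (0<ι (level π e)) o (cong -_ y≡0)
    go lowerʳ o = tent-foot (0<ι (level π e)) o (cong -_ y≡0)

  -- The index confines each sort of slot to the kind that uses it, so a shared slot forces equal
  -- kinds, whose rungs form a chain.
  data Foot (e : Rung k l R) (X : ℚ) : Kind → Set where
    at-u  : ∀ {κ} → X ≡ uX (col e) → Foot e X κ
    at-v  : ∀ {κ} → X ≡ vX (row e) → Foot e X κ
    at-sw : X ≡ slotSW e → Foot e X SW
    at-ne : X ≡ slotNE e → Foot e X NE

  foot : ∀ {κ} (π : Part κ) {e x} → OnPart π e x → OnAxis x → Foot e (proj₁ x) κ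
  foot nw-upper o y≡0 = [ at-u , at-v ]′ (part-foot nw-upper o y≡0)
  foot se-lower o y≡0 = [ at-u , at-v ]′ (part-foot se-lower o y≡0)
  foot sw-lower o y≡0 = [ at-u , at-sw ]′ (part-foot sw-lower o y≡0)
  foot sw-upper o y≡0 = [ at-sw , at-v ]′ (part-foot sw-upper o y≡0)
  foot ne-upper o y≡0 = [ at-u , at-ne ]′ (part-foot ne-upper o y≡0)
  foot ne-lower o y≡0 = [ at-v , at-ne ]′ (part-foot ne-lower o y≡0)

  -- For kinds SW and NE the two tents lie on opposite sides of the axis. They can meet only at
  -- feet, and the slot is their only common foot.
  rung-simple : ∀ κ e → SimplePoly (rungPoly κ e)
  rung-simple NW e = simple-tent (left<centre nw-upper e) (centre<right nw-upper e)
  rung-simple SE e = simple-tent (left<centre se-lower e) (centre<right se-lower e)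
  rung-simple SW e = simple-path₄ (simple-tent (left<centre sw-lower e) (centre<right sw-lower e))
    (simple-tent (left<centre sw-upper e) (centre<right sw-upper e)) meet
    where
    lower : ∀ x → OnPoly x ((uX (col e) , 0ℚ) ∷ apex sw-lower e ∷ (slotSW e , 0ℚ) ∷ []) → OnPart sw-lower e x
    lower x (here o)         = onPart (mirror-tent (onLeftLeg o))
    lower x (there (here o)) = onPart (mirror-tent (onRightLeg o))
    upper′ : ∀ x → OnPoly x ((slotSW e , 0ℚ) ∷ apex sw-upper e ∷ (vX (row e) , 0ℚ) ∷ []) → OnPart sw-upper e x
    upper′ x (here o)         = onPart (onLeftLeg o)
    upper′ x (there (here o)) = onPart (onRightLeg o)
    meet : ∀ x → OnPoly x ((uX (col e) , 0ℚ) ∷ apex sw-lower e ∷ (slotSW e , 0ℚ) ∷ []) →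
      OnPoly x ((slotSW e , 0ℚ) ∷ apex sw-upper e ∷ (vX (row e) , 0ℚ) ∷ []) → x ≡ (slotSW e , 0ℚ)
    meet x o o' = at (upper-lowerˡ sw-upper sw-lower e e refl refl x (upper′ x o') (lower x o))
      where
      at : OnAxis x → x ≡ (slotSW e , 0ℚ)
      at y≡0 = shared-foot y≡0 (uX<vX (col e) (row e)) (part-foot sw-lower (lower x o) y≡0)
        (part-foot sw-upper (upper′ x o') y≡0)
  rung-simple NE e = simple-path₄ (simple-tent (left<centre ne-upper e) (centre<right ne-upper e))
    (simple-tent-reversed (left<centre ne-lower e) (centre<right ne-lower e)) meet
    where
    upper′ : ∀ x → OnPoly x ((uX (col e) , 0ℚ) ∷ apex ne-upper e ∷ (slotNE e , 0ℚ) ∷ []) → OnPart ne-upper e x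
    upper′ x (here o)         = onPart (onLeftLeg o)
    upper′ x (there (here o)) = onPart (onRightLeg o)
    lower : ∀ x → OnPoly x ((slotNE e , 0ℚ) ∷ apex ne-lower e ∷ (vX (row e) , 0ℚ) ∷ []) → OnPart ne-lower e x
    lower x (here o) =
      onPart (mirror-tent (onRightLeg (onSeg-sym (slotNE e , 0ℚ) (apex ne-lower e) o)))
    lower x (there (here o)) =
      onPart (mirror-tent (onLeftLeg (onSeg-sym (apex ne-lower e) (vX (row e) , 0ℚ) o)))
    meet : ∀ x → OnPoly x ((uX (col e) , 0ℚ) ∷ apex ne-upper e ∷ (slotNE e , 0ℚ) ∷ []) →
      OnPoly x ((slotNE e , 0ℚ) ∷ apex ne-lower e ∷ (vX (row e) , 0ℚ) ∷ []) → x ≡ (slotNE e , 0ℚ)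
    meet x o o' = at (upper-lowerʳ ne-upper ne-lower e e refl refl x (upper′ x o) (lower x o'))
      where
      at : OnAxis x → x ≡ (slotNE e , 0ℚ)
      at y≡0 = shared-foot y≡0 (uX<vX (col e) (row e)) (part-foot ne-upper (upper′ x o) y≡0)
        (Sum.swap (part-foot ne-lower (lower x o') y≡0))

  position : Fin (suc k) ⊎ Fin (suc l) → Point
  position (inj₁ i) = uX (toℕ i) , 0ℚ
  position (inj₂ j) = vX (toℕ j) , 0ℚ

  position-injective : ∀ v w → position v ≡ position w → v ≡ w
  position-injective (inj₁ i) (inj₁ i') e = cong inj₁ (Finₚ.toℕ-injective (uX-injective (cong proj₁ e)))
  position-injective (inj₁ i) (inj₂ j) e = ⊥-elim (<⇒≢ₓ (uX<vX (toℕ i) (toℕ j)) e)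
  position-injective (inj₂ j) (inj₁ i) e = ⊥-elim (>⇒≢ₓ (uX<vX (toℕ i) (toℕ j)) e)
  position-injective (inj₂ j) (inj₂ j') e = cong inj₂ (Finₚ.toℕ-injective (vX-injective (cong proj₁ e)))

  IsPosition : Point → Set
  IsPosition x = Σ (Fin (suc k) ⊎ Fin (suc l)) λ v → x ≡ position v

  position-u : ∀ {x} (e : Rung k l R) → OnAxis x → proj₁ x ≡ uX (col e) → IsPosition x
  position-u ((i , _) , _) y≡0 x≡ = inj₁ i , cong₂ _,_ x≡ y≡0

  position-v : ∀ {x} (e : Rung k l R) → OnAxis x → proj₁ x ≡ vX (row e) → IsPosition x
  position-v ((_ , j) , _) y≡0 x≡ = inj₂ j , cong₂ _,_ x≡ y≡0

  -- A foot that is an end of a rung is a vertex. Two slots of the same sort differ because the rank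
  -- is strictly monotone along the chain, and SW slots lie left of NE slots.
  common-foot : ∀ {κ κ' e e' x} → HasKind e κ → HasKind e' κ' → Distinct e e' → OnAxis x →
    Foot e (proj₁ x) κ → Foot e' (proj₁ x) κ' → IsPosition x
  common-foot {e = e} _ _ _ y≡0 (at-u x≡) _ = position-u e y≡0 x≡
  common-foot {e = e} _ _ _ y≡0 (at-v x≡) _ = position-v e y≡0 x≡
  common-foot {e' = e'} _ _ _ y≡0 (at-sw _) (at-u x≡) = position-u e' y≡0 x≡
  common-foot {e' = e'} _ _ _ y≡0 (at-sw _) (at-v x≡) = position-v e' y≡0 x≡
  common-foot {e = e} {e'} h h' d y≡0 (at-sw x≡) (at-sw x≡')
    with sw-decreasing h h' | ℕₚ.suc-injective (-ι-injective (trans (sym x≡) x≡'))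
  ... | inj₁ c | s≡s' = ⊥-elim (ℕₚ.<-irrefl (sym s≡s') (decreasing⇒coskew> d c))
  ... | inj₂ c | s≡s' = ⊥-elim (ℕₚ.<-irrefl s≡s' (decreasing⇒coskew> (distinct-sym d) c))
  common-foot {e = e} {e'} _ _ _ y≡0 (at-sw x≡) (at-ne x≡') = ⊥-elim (absurd-< x≡ x≡' (slotSW<slotNE e e'))
  common-foot {e' = e'} _ _ _ y≡0 (at-ne _) (at-u x≡) = position-u e' y≡0 x≡
  common-foot {e' = e'} _ _ _ y≡0 (at-ne _) (at-v x≡) = position-v e' y≡0 x≡
  common-foot {e = e} {e'} _ _ _ y≡0 (at-ne x≡) (at-sw x≡') = ⊥-elim (absurd-< x≡' x≡ (slotSW<slotNE e' e))
  common-foot {e = e} {e'} h h' d y≡0 (at-ne x≡) (at-ne x≡')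
    with ne-decreasing h h'
       | ℕₚ.+-cancelˡ-≡ l _ _ (ℕₚ.suc-injective (ℕₚ.suc-injective (ℕₚ.suc-injective (ι-injective (trans (sym x≡) x≡')))))
  ... | inj₁ c | t≡t' = ⊥-elim (ℕₚ.<-irrefl t≡t' (decreasing⇒skew< d c))
  ... | inj₂ c | t≡t' = ⊥-elim (ℕₚ.<-irrefl (sym t≡t') (decreasing⇒skew< (distinct-sym d) c))

  -- Assembly of the drawing

  module _ (kind : ∀ e → ∃ (HasKind e)) where

    bendsOf : LadderEdge k l R → List Point
    bendsOf (uEdge _)    = []
    bendsOf (vEdge _)    = []
    bendsOf (rung i j r) = rungBends (proj₁ (kind ((i , j) , r))) ((i , j) , r)

    polyOf : LadderEdge k l R → List Point
    polyOf e = position (lsrc e) ∷ (bendsOf e ++ [ position (ltgt e) ])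

    -- The `u` positions run from right to left, so the segment is reversed before its bounds are
    -- read off.
    onUEdge : ∀ i {x} → OnPoly x (polyOf (uEdge i)) →
      OnAxis x × uX (suc (toℕ i)) ≤ proj₁ x × proj₁ x ≤ uX (toℕ i)
    onUEdge i {x} (here o) = axis-segment (uX-anti-≤ (ℕₚ.n≤1+n (toℕ i)))
      (subst (λ m → OnSeg x ((uX (suc (toℕ i)) , 0ℚ) , (uX m , 0ℚ))) (Finₚ.toℕ-inject₁ i)
        (onSeg-sym (position (inj₁ (inject₁ i))) (position (inj₁ (suc i))) o))

    onVEdge : ∀ j {x} → OnPoly x (polyOf (vEdge j)) →
      OnAxis x × vX (toℕ j) ≤ proj₁ x × proj₁ x ≤ vX (suc (toℕ j))
    onVEdge j {x} (here o) = axis-segment (ι-mono-≤ (ℕ.s≤s (ℕₚ.n≤1+n (toℕ j))))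
      (subst (λ m → OnSeg x ((vX m , 0ℚ) , (vX (suc (toℕ j)) , 0ℚ))) (Finₚ.toℕ-inject₁ j) o)

    avoids : ∀ e v → OnPoly (position v) (polyOf e) → v ≡ lsrc e ⊎ v ≡ ltgt e
    avoids (uEdge i) (inj₁ m) o with onUEdge i o
    ... | _ , h , h' = Sum.map
      (λ eq → cong inj₁ (Finₚ.toℕ-injective (trans eq (sym (Finₚ.toℕ-inject₁ i)))))
      (λ eq → cong inj₁ (Finₚ.toℕ-injective eq))
      (squeeze (uX-cancel-≤ h') (uX-cancel-≤ h))
    avoids (uEdge i) (inj₂ m) o with onUEdge i o
    ... | _ , _ , h' = ⊥-elim (≤-<-absurd h' (uX<vX (toℕ i) (toℕ m)))
    avoids (vEdge j) (inj₁ m) o with onVEdge j o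
    ... | _ , h , _ = ⊥-elim (≤-<-absurd h (uX<vX (toℕ m) (toℕ j)))
    avoids (vEdge j) (inj₂ m) o with onVEdge j o
    ... | _ , h , h' = Sum.map
      (λ eq → cong inj₂ (Finₚ.toℕ-injective (trans eq (sym (Finₚ.toℕ-inject₁ j)))))
      (λ eq → cong inj₂ (Finₚ.toℕ-injective eq))
      (squeeze (vX-cancel-≤ h) (vX-cancel-≤ h'))
    avoids (rung i j r) v o with onRung (proj₁ (kind ((i , j) , r))) ((i , j) , r) (position v) o
    ... | π , p = ends v (foot π p (on-axis v))
      where
      on-axis : ∀ v → OnAxis (position v)
      on-axis (inj₁ _) = refl
      on-axis (inj₂ _) = refl
      e₀ : Rung k l R
      e₀ = (i , j) , r
      ends : ∀ {κ} v → Foot e₀ (proj₁ (position v)) κ → v ≡ inj₁ i ⊎ v ≡ inj₂ j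
      ends (inj₁ m) (at-u eq)  = inj₁ (cong inj₁ (Finₚ.toℕ-injective (uX-injective eq)))
      ends (inj₁ m) (at-v eq)  = ⊥-elim (absurd-< refl eq (uX<vX (toℕ m) (toℕ j)))
      ends (inj₁ m) (at-sw eq) = ⊥-elim (absurd-< refl eq (uX<slotSW (toℕ m) e₀))
      ends (inj₁ m) (at-ne eq) = ⊥-elim (absurd-< refl eq (uX<slotNE (toℕ m) e₀))
      ends (inj₂ m) (at-u eq)  = ⊥-elim (absurd-< eq refl (uX<vX (toℕ i) (toℕ m)))
      ends (inj₂ m) (at-v eq)  = inj₂ (cong inj₂ (Finₚ.toℕ-injective (vX-injective eq)))
      ends (inj₂ m) (at-sw eq) = ⊥-elim (absurd-< eq refl (slotSW<vX e₀ (toℕ m)))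
      ends (inj₂ m) (at-ne eq) = ⊥-elim (absurd-< refl eq (vX<slotNE (toℕ m) e₀ (Finₚ.toℕ≤pred[n] m)))

    consecutive-u : ∀ i i' x → i Fin.< i' → OnPoly x (polyOf (uEdge i)) → OnPoly x (polyOf (uEdge i')) → IsPosition x
    consecutive-u i i' x i<i' o o' with onUEdge i o | onUEdge i' o'
    ... | y≡0 , h₁ , _ | _ , _ , h₂ = inj₁ (suc i) ,
      cong₂ _,_ (ℚₚ.≤-antisym (ℚₚ.≤-trans h₂ (uX-anti-≤ i<i')) h₁) y≡0

    consecutive-v : ∀ j j' x → j Fin.< j' → OnPoly x (polyOf (vEdge j)) → OnPoly x (polyOf (vEdge j')) → IsPosition x
    consecutive-v j j' x j<j' o o' with onVEdge j o | onVEdge j' o'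
    ... | y≡0 , _ , h₁ | _ , h₂ , _ = inj₂ (suc j) ,
      cong₂ _,_ (ℚₚ.≤-antisym h₁ (ℚₚ.≤-trans (ι-mono-≤ (ℕ.s≤s j<j')) h₂)) y≡0

    u-v-disjoint : ∀ i j x → OnPoly x (polyOf (uEdge i)) → OnPoly x (polyOf (vEdge j)) → ⊥
    u-v-disjoint i j x o o' with onUEdge i o | onVEdge j o'
    ... | _ , _ , h | _ , h' , _ = ≤-<-absurd (ℚₚ.≤-trans h' h) (uX<vX (toℕ i) (toℕ j))

    rung-u : ∀ i e x → OnPoly x (polyOf (uEdge i)) → OnPoly x (rungPoly (proj₁ (kind e)) e) → IsPosition x
    rung-u i e x o o' with onUEdge i o | onRung (proj₁ (kind e)) e x o'
    ... | y≡0 , _ , h | π , p = at (foot π p y≡0)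
      where
      at : ∀ {κ} → Foot e (proj₁ x) κ → IsPosition x
      at (at-u eq)  = position-u e y≡0 eq
      at (at-v eq)  = position-v e y≡0 eq
      at (at-sw eq) = ⊥-elim (≤-<-absurd (subst (_≤ uX (toℕ i)) eq h) (uX<slotSW (toℕ i) e))
      at (at-ne eq) = ⊥-elim (≤-<-absurd (subst (_≤ uX (toℕ i)) eq h) (uX<slotNE (toℕ i) e))

    rung-v : ∀ j e x → OnPoly x (polyOf (vEdge j)) → OnPoly x (rungPoly (proj₁ (kind e)) e) → IsPosition x
    rung-v j e x o o' with onVEdge j o | onRung (proj₁ (kind e)) e x o'
    ... | y≡0 , h , h' | π , p = at (foot π p y≡0)
      where
      at : ∀ {κ} → Foot e (proj₁ x) κ → IsPosition x
      at (at-u eq)  = position-u e y≡0 eq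
      at (at-v eq)  = position-v e y≡0 eq
      at (at-sw eq) = ⊥-elim (≤-<-absurd (subst (vX (toℕ j) ≤_) eq h) (slotSW<vX e (toℕ j)))
      -- The right end of the edge has index at most `l`, hence is still left of all NE slots.
      at (at-ne eq) =
        ⊥-elim (≤-<-absurd (subst (_≤ vX (suc (toℕ j))) eq h') (vX<slotNE (suc (toℕ j)) e (Finₚ.toℕ<n j)))

    rung-rung : ∀ e e' x → Distinct e e' →
      OnPoly x (rungPoly (proj₁ (kind e)) e) → OnPoly x (rungPoly (proj₁ (kind e')) e') → IsPosition x
    rung-rung e e' x d o o' with onRung (proj₁ (kind e)) e x o | onRung (proj₁ (kind e')) e' x o'
    ... | π , p | π' , p' = common-foot (proj₂ (kind e)) (proj₂ (kind e')) d y≡0 (foot π p y≡0) (foot π' p' y≡0)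
      where y≡0 = parts-meet π π' (proj₂ (kind e)) (proj₂ (kind e')) d x p p'

    -- Proofs of `T (R i j)` are unique, so different rung edges differ in an index: there are no
    -- parallel edges.
    rungs-distinct : ∀ i j r i' j' r' → _≢_ {A = LadderEdge k l R} (rung i j r) (rung i' j' r') →
      Distinct ((i , j) , r) ((i' , j') , r')
    rungs-distinct i j r i' j' r' r≢r' = distinct λ (c , w) → same (Finₚ.toℕ-injective c) (Finₚ.toℕ-injective w)
      where
      same : i ≡ i' → j ≡ j' → ⊥
      same refl refl = r≢r' (cong (rung i j) (T-irrelevant r r'))

    meet : ∀ e f x → e ≢ f → OnPoly x (polyOf e) → OnPoly x (polyOf f) → IsPosition x
    meet (uEdge i) (uEdge i') x e≢f o o' with Finₚ.<-cmp i i'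
    ... | tri< h _ _ = consecutive-u i i' x h o o'
    ... | tri≈ _ h _ = ⊥-elim (e≢f (cong uEdge h))
    ... | tri> _ _ h = consecutive-u i' i x h o' o
    meet (uEdge i) (vEdge j) x _ o o' = ⊥-elim (u-v-disjoint i j x o o')
    meet (uEdge i) (rung i' j' r) x _ o o' = rung-u i ((i' , j') , r) x o o'
    meet (vEdge j) (uEdge i) x _ o o' = ⊥-elim (u-v-disjoint i j x o' o)
    meet (vEdge j) (vEdge j') x e≢f o o' with Finₚ.<-cmp j j'
    ... | tri< h _ _ = consecutive-v j j' x h o o'
    ... | tri≈ _ h _ = ⊥-elim (e≢f (cong vEdge h))
    ... | tri> _ _ h = consecutive-v j' j x h o' o
    meet (vEdge j) (rung i' j' r) x _ o o' = rung-v j ((i' , j') , r) x o o'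
    meet (rung i j r) (uEdge i') x _ o o' = rung-u i' ((i , j) , r) x o' o
    meet (rung i j r) (vEdge j') x _ o o' = rung-v j' ((i , j) , r) x o' o
    meet (rung i j r) (rung i' j' r') x e≢f o o' =
      rung-rung ((i , j) , r) ((i' , j') , r') x (rungs-distinct i j r i' j' r' e≢f) o o'

    simple : ∀ e → SimplePoly (polyOf e)
    simple (uEdge i) = simple-path₁ λ eq →
      ℕₚ.<-irrefl (trans (sym (Finₚ.toℕ-inject₁ i)) (uX-injective (cong proj₁ eq))) (ℕₚ.n<1+n (toℕ i))
    simple (vEdge j) = simple-path₁ λ eq →
      ℕₚ.<-irrefl (trans (sym (Finₚ.toℕ-inject₁ j)) (vX-injective (cong proj₁ eq))) (ℕₚ.n<1+n (toℕ j))
    simple (rung i j r) = rung-simple (proj₁ (kind ((i , j) , r))) ((i , j) , r)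

    drawing : Drawing (Ladder k l R)
    drawing = record
      { pos        = position
      ; bends      = bendsOf
      ; pos-inj    = position-injective
      ; arc-simple = simple
      ; arc-avoids = avoids
      ; arcs-meet  = meet
      }

-- The characterisation of planar ladders

theorem3 : (k l : ℕ) (R : Fin (suc k) → Fin (suc l) → Bool) →
    Planar (Ladder k l R) ⇔
    ((e : Rung k l R) →
    EmptyCap (L↑ e) (R↓ e) ⊎ EmptyCap (L↑ e) (R↑ e) ⊎
    EmptyCap (L↓ e) (R↑ e) ⊎ EmptyCap (L↓ e) (R↓ e))
theorem3 k l R = mk⇔ necessary (λ cond → drawing (λ e → kind e (cond e)))
  where
  Condition : Rung k l R → Set
  Condition e =
    EmptyCap (L↑ e) (R↓ e) ⊎ EmptyCap (L↑ e) (R↑ e) ⊎ EmptyCap (L↓ e) (R↑ e) ⊎ EmptyCap (L↓ e) (R↓ e)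
  necessary : Planar (Ladder k l R) → ∀ e → Condition e
  -- A search among the finitely many rungs decides constructively which quadrant is empty. If none
  -- is, the drawing yields a contradiction.
  necessary D e with emptyQuadrant? e
  ... | inj₁ (qnw , qne , qse , qsw)  = ⊥-elim (planar⇒¬crossed D e qse qne qnw qsw)
  ... | inj₂ (NW , nw ¬q)         = inj₂ (inj₂ (inj₁ ¬q))
  ... | inj₂ (NE , ne _ ¬q)       = inj₂ (inj₁ ¬q)
  ... | inj₂ (SE , se _ _ ¬q)     = inj₁ ¬q
  ... | inj₂ (SW , sw _ _ _ ¬q)   = inj₂ (inj₂ (inj₂ ¬q))
  kind : ∀ e → Condition e → ∃ (HasKind e)
  -- The kind is taken from the search, so that it respects the priority. The assumed empty quadrant
  -- only refutes the case of four occupied ones.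
  kind e cond with emptyQuadrant? e | cond
  ... | inj₂ κ                    | _                       = κ
  ... | inj₁ (qnw , qne , qse , qsw)  | inj₁ ¬q                 = ⊥-elim (¬q qse)
  ... | inj₁ (qnw , qne , qse , qsw)  | inj₂ (inj₁ ¬q)          = ⊥-elim (¬q qne)
  ... | inj₁ (qnw , qne , qse , qsw)  | inj₂ (inj₂ (inj₁ ¬q))   = ⊥-elim (¬q qnw)
  ... | inj₁ (qnw , qne , qse , qsw)  | inj₂ (inj₂ (inj₂ ¬q))   = ⊥-elim (¬q qsw)
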